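{- Let $\Phi\in\{B_n,C_n,D_n\}$ and fix any $\mathbf s\in{\rm Score}(\Phi)$. Then the Coxeter interchange graph ${\rm IntGr}(\Phi,\mathbf s)$ is connected and its diameter (maximal graph distance between two vertices) is $O(n^2)$, with implied constant independent of $n$ and $\mathbf s$.
   Context: Signed graphs. Let $[n]=\{1,\dots,n\}$ and let $\mathbf e_1,\dots,\mathbf e_n$ be the standard basis of $\mathbb R^n$. A signed graph on $[n]$ has signed edges of four kinds: negative edges $e^-_{ij}$ and positive edges $e^+_{ij}$ between distinct vertices $i,j$, half edges $e^h_i$ and loops $e^\ell_i$ at a vertex $i$. Vectors: $\mathbf e^{\pm}_{ij}=\mathbf e_i\pm\mathbf e_j$ (for $i>j$), $\mathbf e^h_i=\mathbf e_i$, $\mathbf e^\ell_i=2\mathbf e_i$. $\mathcal K_{D_n}$ contains all negative and positive edges (one of each per pair); $\mathcal K_{B_n}$ contains these plus all half edges; $\mathcal K_{C_n}$ contains all negative and positive edges plus all loops. A Coxeter tournament $\mathcal T$ on a signed graph $\mathcal S$ is a family $(w_e)_{e\in E(\mathcal S)}$, $w_e\in\{0,1\}$ (edges are "games"); its score sequence is $\mathbf s(\mathcal T)=\sum_e(w_e-\frac12)\mathbf e$. A sub-tournament is the restriction to a subset of games; it is neutral if the corresponding sum over its games is $\mathbf 0$. $\mathcal T*\mathcal X$ flips $w_e\mapsto1-w_e$ for the games $e$ of $\mathcal X\subseteq\mathcal T$. ${\rm Score}(\Phi)$ is the set of score sequences of tournaments on $\mathcal K_\Phi$; ${\rm Tour}(\Phi,\mathbf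 s)$ the set of tournaments on $\mathcal K_\Phi$ with score $\mathbf s$. A copy of a type-$\Phi$ generator in $\mathcal T$ is a neutral sub-tournament whose games are: (a) (all types) three negative edges pairwise joining three distinct vertices, or one negative and two positive edges pairwise joining three distinct vertices (one edge per pair); (b) (only $B_n$) a negative or positive edge between $i\ne j$ plus half edges $e^h_i,e^h_j$; (c) (only $C_n$, "neutral clover") $e^-_{ij},e^+_{ij},e^\ell_i$. ${\rm IntGr}(\Phi,\mathbf s)$ is the multigraph on ${\rm Tour}(\Phi,\mathbf s)$ where $\mathcal T_1,\mathcal T_2$ are joined iff $\mathcal T_2=\mathcal T_1*\mathcal G$ for a copy $\mathcal G$ of a type-$\Phi$ generator in $\mathcal T_1$, by a double edge if $\mathcal G$ is a neutral clover and a single edge otherwise. -}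

module Defs where

open import Data.Nat using (ℕ; zero; suc)
open import Data.Bool using (Bool; true; false; if_then_else_; not)
open import Data.Unit using (⊤; tt)
open import Data.Empty using (⊥)
open import Data.Fin using (Fin; _<_; _<?_; _≟_)
open import Data.List using (List; []; _∷_; _++_; map; concatMap; allFin; foldr)
open import Data.Integer using (ℤ; +_; -[1+_]; _+_; _-_; _*_)
open import Data.Product using (Σ; _×_; _,_)
open import Relation.Nullary using (¬_; yes; no)
open import Relation.Nullary.Decidable using (⌊_⌋)
open import Relation.Binary.PropositionalEquality using (_≡_)
open import Data.List.Membership.Propositional using (_∈_)

data CoxType : Set where
  B C D : CoxType

IsB : CoxType → Set
IsB B = ⊤
IsB _ = ⊥

IsC : CoxType → Set
IsC C = ⊤
IsC _ = ⊥

-- Edges of the complete signed graph K_Φ on vertex set [n] = Fin n.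
-- A negative/positive edge between i ≠ j is recorded once, as (i , j) with j < i.
-- Half edges exist only for type B, loops only for type C.
data Edge (Φ : CoxType) (n : ℕ) : Set where
  neg  : (i j : Fin n) → j < i → Edge Φ n
  pos  : (i j : Fin n) → j < i → Edge Φ n
  half : Fin n → IsB Φ → Edge Φ n
  loop : Fin n → IsC Φ → Edge Φ n

δ : ∀ {n} → Fin n → Fin n → ℤ
δ i k = if ⌊ i ≟ k ⌋ then + 1 else + 0

vec : ∀ {Φ n} → Edge Φ n → Fin n → ℤ
vec (neg i j _) k = δ i k - δ j k
vec (pos i j _) k = δ i k + δ j k
vec (half i _)  k = δ i k
vec (loop i _)  k = + 2 * δ i k

pairEdges : ∀ {Φ n} → Fin n → Fin n → List (Edge Φ n)
pairEdges i j with j <? i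
... | yes p = neg i j p ∷ pos i j p ∷ []
... | no _  = []

halfEdges : (Φ : CoxType) (n : ℕ) → List (Edge Φ n)
halfEdges B n = map (λ i → half i tt) (allFin n)
halfEdges C n = []
halfEdges D n = []

loopEdges : (Φ : CoxType) (n : ℕ) → List (Edge Φ n)
loopEdges B n = []
loopEdges C n = map (λ i → loop i tt) (allFin n)
loopEdges D n = []

allEdges : (Φ : CoxType) (n : ℕ) → List (Edge Φ n)
allEdges Φ n =
  concatMap (λ i → concatMap (λ j → pairEdges i j) (allFin n)) (allFin n)
  ++ halfEdges Φ n ++ loopEdges Φ n

-- A Coxeter tournament on K_Φ: an outcome w_e ∈ {0,1} (false/true) per game.
Tournament : CoxType → ℕ → Set
Tournament Φ n = Edge Φ n → Bool

sumℤ : List ℤ → ℤ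
sumℤ = foldr _+_ (+ 0)

-- 2 w_e - 1 ∈ {-1, +1}
sgn : Bool → ℤ
sgn true  = + 1
sgn false = -[1+ 0 ]

-- k-th coordinate of  2 · Σ_{e ∈ games} (w_e - 1/2) e   (doubled to stay in ℤ).
twiceSum : ∀ {Φ n} → Tournament Φ n → List (Edge Φ n) → Fin n → ℤ
twiceSum T G k = sumℤ (map (λ e → sgn (T e) * vec e k) G)

twiceScore : ∀ {Φ n} → Tournament Φ n → Fin n → ℤ
twiceScore {Φ} {n} T = twiceSum T (allEdges Φ n)

Neutral : ∀ {Φ n} → Tournament Φ n → List (Edge Φ n) → Set
Neutral {n = n} T G = (k : Fin n) → twiceSum T G k ≡ + 0

-- Sets of games forming (the shape of) a copy of a type-Φ generator.
-- Vertices a > b > c (resp. a > b) are distinct; every unordered pair is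
-- recorded with the larger vertex first.
data GenShape {Φ : CoxType} {n : ℕ} : List (Edge Φ n) → Set where
  triNeg : (a b c : Fin n) (ab : b < a) (ac : c < a) (bc : c < b) →
           GenShape (neg a b ab ∷ neg a c ac ∷ neg b c bc ∷ [])
  triMix₁ : (a b c : Fin n) (ab : b < a) (ac : c < a) (bc : c < b) →
           GenShape (neg a b ab ∷ pos a c ac ∷ pos b c bc ∷ [])
  triMix₂ : (a b c : Fin n) (ab : b < a) (ac : c < a) (bc : c < b) →
           GenShape (pos a b ab ∷ neg a c ac ∷ pos b c bc ∷ [])
  triMix₃ : (a b c : Fin n) (ab : b < a) (ac : c < a) (bc : c < b) →
           GenShape (pos a b ab ∷ pos a c ac ∷ neg b c bc ∷ [])
  halfNeg : (a b : Fin n) (ab : b < a) (h : IsB Φ) →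
           GenShape (neg a b ab ∷ half a h ∷ half b h ∷ [])
  halfPos : (a b : Fin n) (ab : b < a) (h : IsB Φ) →
           GenShape (pos a b ab ∷ half a h ∷ half b h ∷ [])
  clover₁ : (a b : Fin n) (ab : b < a) (h : IsC Φ) →
           GenShape (neg a b ab ∷ pos a b ab ∷ loop a h ∷ [])
  clover₂ : (a b : Fin n) (ab : b < a) (h : IsC Φ) →
           GenShape (neg a b ab ∷ pos a b ab ∷ loop b h ∷ [])

-- U = T * G for a copy G of a type-Φ generator in T (an edge of IntGr).
Step : ∀ {Φ n} → Tournament Φ n → Tournament Φ n → Set
Step {Φ} {n} T U =
  Σ (List (Edge Φ n)) λ G →
    GenShape G × Neutral T G ×
    ((e : Edge Φ n) → (e ∈ G → U e ≡ not (T e)) × (¬ (e ∈ G) → U e ≡ T e))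

data Path {Φ : CoxType} {n : ℕ} : Tournament Φ n → Tournament Φ n → ℕ → Set where
  done : ∀ {T T'} → ((e : Edge Φ n) → T e ≡ T' e) → Path T T' zero
  step : ∀ {T U T' k} → Step T U → Path U T' k → Path T T' (suc k)

{-# OPTIONS --safe #-}

-- Write x − y for signed vertices x = ±eᵢ, y = ±eⱼ (i ≠ j).  Every pair edge with its outcome
-- contributes such a vector, read as "x beats y", and a generator triangle is a cyclic triangle.
-- Vertices v = 0, 1, … are treated in turn: with moves on either of the two tournaments they are
-- made to agree on all edges at v, without spoiling the edges at smaller vertices.  One move
-- corrects the half edge or loop at v.  If v beats x and loses to y in T₁ but not in T₂, flip the
-- triangle v, x, y in whichever tournament has it cyclic.  If neither has, y beats x in T₁ and x
-- beats y in T₂; comparing the difference of the scores of x and y in T₁ and T₂ yields a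
-- generator through x and y which reverses this game.  When the only correction available
-- for x is its own negative, a triangle through a third vertex z first trades x for z.
-- So each of the 2n edges at v costs at most three moves, and all vertices O(n²).
module Submission where

open import Defs
open import Algebra.Bundles using (CommutativeMonoid)
open import Data.Bool using (Bool; true; false; not)
import Data.Bool.Properties as 𝔹
open import Data.Empty using (⊥)
import Data.Empty.Irrelevant as Irrelevant
open import Data.Fin using (Fin; zero; suc; _<_; _<?_; _≤_; toℕ; fromℕ<)
import Data.Fin.Properties as F
open import Data.Integer using (ℤ; +_; -[1+_]; _+_; _-_; _*_; -_; 0ℤ; 1ℤ; +<+) renaming (_<_ to _<ᶻ_; _≤_ to _≤ᶻ_)
import Data.Integer.Properties as ℤₚ
open import Data.Integer.Tactic.RingSolver using (solve-∀)
open import Data.List using (List; []; _∷_; _++_; map; concatMap; allFin; tabulate; length; cartesianProduct)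
open import Data.List.Membership.Propositional using (_∈_; _∉_)
import Data.List.Membership.DecPropositional as DecMembership
open import Data.List.Membership.Propositional.Properties using (∈-cartesianProduct⁺; ∈-allFin)
open import Data.List.Properties using (map-++; map-tabulate; map-∘; map-cong; ++-identityʳ; length-tabulate)
open import Data.List.Relation.Binary.Permutation.Propositional using (_↭_; refl; prep; ↭-sym) renaming (swap to ↭swap; trans to ↭trans)
open import Data.List.Relation.Binary.Permutation.Propositional.Properties using (∈-resp-↭)
open import Data.List.Relation.Unary.All using ([]; _∷_)
import Data.List.Relation.Unary.All.Properties as All
open import Data.List.Relation.Unary.AllPairs using ([]; _∷_)
open import Data.List.Relation.Unary.Any using (here; there)
open import Data.List.Relation.Unary.Unique.Propositional using (Unique)
open import Data.Nat using (ℕ; zero; suc; z≤n; s≤s) renaming (_+_ to _ℕ+_; _*_ to _ℕ*_)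
import Data.Nat as ℕ
import Data.Nat.Properties as ℕₚ
import Data.Nat.Tactic.RingSolver as ℕSolver
open import Data.Product using (Σ; ∃; ∃-syntax; _×_; _,_; proj₁; proj₂)
import Data.Sum as Sum
open import Data.Sum using (_⊎_; inj₁; inj₂; [_,_]′)
open import Data.Unit using (tt)
open import Function using (_∘_; id)
open import Relation.Binary.Definitions using (DecidableEquality; Tri; tri<; tri≈; tri>)
open import Relation.Binary.PropositionalEquality using (_≡_; _≢_; refl; sym; trans; cong; cong₂; subst; subst₂; ≢-sym; module ≡-Reasoning)
open import Relation.Nullary using (¬_; Dec; yes; no; contradiction)
open import Relation.Nullary.Decidable using (True; toWitness; map′; _×-dec_; _⊎-dec_; _→-dec_; ¬?)
open import Algebra.Properties.AbelianGroup ℤₚ.+-0-abelianGroup using (identityʳ-unique)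
open import Algebra.Properties.CommutativeSemigroup (CommutativeMonoid.commutativeSemigroup ℤₚ.+-0-commutativeMonoid) using (interchange)
open import Algebra.Properties.CommutativeMonoid.Sum ℤₚ.+-0-commutativeMonoid using (sum; sum-cong-≗; ∑-distrib-+; ∑-comm; sum-replicate-zero)

-- Every existence claim rests on one principle: since the scores agree, the differences between the
-- two tournaments along the games of a signed vertex sum to zero, so an excess at known entries
-- forces a deficit at another one. Smaller vertices contribute nothing, as their games already
-- agree; hence the new opponent lies above `v`, where games may still be spoilt freely. This is why
-- the half edge or loop at `v` comes first: once it agrees, the spokes of `v` must balance among
-- themselves. If no other vertex has a spoke that differs in the opposite direction, every entry of
-- the row of `v` is nonnegative, hence zero, and only the spokes of `x` and `~ x` differ. They join
-- the same two vertices, so no triangle contains both, and the trade through `z` separates them. In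
-- type C the loop at x may absorb the whole excess, so that no `z` is forced; then a clover
-- corrects both spokes at once.

-- Finite sums and the compensation principle

module _ {A : Set} (_≟ᴬ_ : DecidableEquality A) where
  open DecMembership _≟ᴬ_ using (_∈?_)

  maskOut : List A → (A → ℤ) → A → ℤ
  maskOut L f a with a ∈? L
  ... | yes _ = 0ℤ
  ... | no  _ = f a

  maskOut-∉ : ∀ {L a} f → a ∉ L → maskOut L f a ≡ f a
  maskOut-∉ {L} {a} f a∉L with a ∈? L
  ... | yes a∈L = contradiction a∈L a∉L
  ... | no _ = refl

  onlyAt : A → (A → ℤ) → A → ℤ
  onlyAt g f a with a ≟ᴬ g
  ... | yes _ = f a
  ... | no  _ = 0ℤ

  onlyAt-≡ : ∀ g f → onlyAt g f g ≡ f g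
  onlyAt-≡ g f with g ≟ᴬ g
  ... | yes _ = refl
  ... | no g≢g = contradiction refl g≢g

  onlyAt-≢ : ∀ {g a} f → a ≢ g → onlyAt g f a ≡ 0ℤ
  onlyAt-≢ {g} {a} f a≢g with a ≟ᴬ g
  ... | yes a≡g = contradiction a≡g a≢g
  ... | no _ = refl

  -- Shared by `sum` over `Fin n` and `sumᴱ` over the list of all games. `S-point` says that each
  -- element is counted exactly once.
  record IsSummation (S : (A → ℤ) → ℤ) : Set where
    field
      S-cong  : ∀ {f g} → (∀ a → f a ≡ g a) → S f ≡ S g
      S-+     : ∀ f g → S (λ a → f a + g a) ≡ S f + S g
      S-point : ∀ f a → (∀ b → b ≢ a → f b ≡ 0ℤ) → S f ≡ f a

    -- The zero function satisfies f + f = f, so its sum equals its own double. `S-point` would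
    -- require an element of `A`, which may be empty.
    S-zero : ∀ {f} → (∀ a → f a ≡ 0ℤ) → S f ≡ 0ℤ
    S-zero {f} f≡0 = identityʳ-unique (S f) (S f) (trans (sym (S-+ f f)) (S-cong double))
      where
      double : ∀ a → f a + f a ≡ f a
      double a rewrite f≡0 a = refl

    -- Each entry `g` in turn is moved out of the masked remainder as a function supported at `g`,
    -- which `S-point` evaluates; distinctness ensures that `g` was not masked before.
    S-split : ∀ f {L} → Unique L → S f ≡ sumℤ (map f L) + S (maskOut L f)
    S-split f [] = sym (trans (ℤₚ.+-identityˡ _) (S-cong λ a → maskOut-∉ {[]} f λ ()))
    S-split f {g ∷ L} (g∉L ∷ uL) = begin
      S f                                                    ≡⟨ S-split f uL ⟩
      sumℤ (map f L) + S (maskOut L f)                       ≡⟨ cong (_+_ (sumℤ (map f L)))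
          (trans (S-cong split) (S-+ (onlyAt g f) (maskOut (g ∷ L) f))) ⟩
      sumℤ (map f L) + (S (onlyAt g f) + S (maskOut (g ∷ L) f))
        ≡⟨ cong (λ z → sumℤ (map f L) + (z + S (maskOut (g ∷ L) f)))
            (trans (S-point (onlyAt g f) g λ b → onlyAt-≢ f) (onlyAt-≡ g f)) ⟩
      sumℤ (map f L) + (f g + S (maskOut (g ∷ L) f))         ≡⟨ exchange (sumℤ (map f L)) (f g)
          (S (maskOut (g ∷ L) f)) ⟩
      f g + sumℤ (map f L) + S (maskOut (g ∷ L) f)           ∎
      where
      open ≡-Reasoning
      exchange : ∀ a b c → a + (b + c) ≡ b + a + c
      exchange = solve-∀
      split : ∀ a → maskOut L f a ≡ onlyAt g f a + maskOut (g ∷ L) f a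
      split a with a ≟ᴬ g
      ... | yes refl rewrite maskOut-∉ {L} f (All.All¬⇒¬Any g∉L) = sym (ℤₚ.+-identityʳ _)
      ... | no a≢g with a ∈? L
      ...   | yes _ = refl
      ...   | no  _ = sym (ℤₚ.+-identityˡ _)

    S-support : ∀ f {L} → Unique L → (∀ a → a ∉ L → f a ≡ 0ℤ) → S f ≡ sumℤ (map f L)
    S-support f {L} uL f≡0 = trans (S-split f uL)
      (trans (cong (_+_ (sumℤ (map f L))) (S-zero off)) (ℤₚ.+-identityʳ _))
      where
      off : ∀ a → maskOut L f a ≡ 0ℤ
      off a with a ∈? L
      ... | yes _ = refl
      ... | no a∉L = f≡0 a a∉L

sum-zero : ∀ {n} {f : Fin n → ℤ} → (∀ i → f i ≡ 0ℤ) → sum f ≡ 0ℤ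
sum-zero {n} f≡0 = trans (sum-cong-≗ f≡0) (sum-replicate-zero n)

sum-point : ∀ {n} (f : Fin n → ℤ) i → (∀ j → j ≢ i → f j ≡ 0ℤ) → sum f ≡ f i
sum-point f zero f≡0 = trans (cong (_+_ (f zero)) (sum-zero λ j → f≡0 (suc j) λ ())) (ℤₚ.+-identityʳ _)
sum-point f (suc i) f≡0 = trans (cong₂ _+_ (f≡0 zero λ ())
  (sum-point (f ∘ suc) i λ j j≢i → f≡0 (suc j) (j≢i ∘ F.suc-injective))) (ℤₚ.+-identityˡ _)

sum-isSummation : ∀ {n} → IsSummation F._≟_ (sum {n})
sum-isSummation = record { S-cong = sum-cong-≗ ; S-+ = ∑-distrib-+ ; S-point = sum-point }

sum-negative : ∀ {n} (f : Fin n → ℤ) → sum f <ᶻ 0ℤ → ∃[ k ] f k <ᶻ 0ℤ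
sum-negative {zero} f (+<+ ())
sum-negative {suc n} f sum<0 with f zero ℤₚ.<? 0ℤ
... | yes f0<0 = zero , f0<0
... | no  f0≮0 with sum-negative (f ∘ suc) (ℤₚ.≤-<-trans bound sum<0)
  where
  bound : sum (f ∘ suc) ≤ᶻ f zero + sum (f ∘ suc)
  bound = subst (_≤ᶻ f zero + sum (f ∘ suc)) (ℤₚ.+-identityˡ _) (ℤₚ.+-monoˡ-≤ _ (ℤₚ.≮⇒≥ f0≮0))
... | k , fk<0 = suc k , fk<0

-- The entries outside `L` sum to minus those in `L`. Applied to differences of tournaments with
-- equal scores, this produces the opponents needed for the moves.
sum-compensate : ∀ {n} (f : Fin n → ℤ) {L} → Unique L → sum f ≡ 0ℤ → 0ℤ <ᶻ sumℤ (map f L) →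
                 ∃[ k ] k ∉ L × f k <ᶻ 0ℤ
sum-compensate f {L} uL sum≡0 0<L = unmask (sum-negative _ rest<0)
  where
  open IsSummation sum-isSummation
  open DecMembership F._≟_ using (_∈?_)
  rest<0 : sum (maskOut F._≟_ L f) <ᶻ 0ℤ
  rest<0 = subst₂ _<ᶻ_ (ℤₚ.+-identityˡ _) (trans (sym (S-split f uL)) sum≡0) (ℤₚ.+-monoˡ-< _ 0<L)
  unmask : (∃[ k ] maskOut F._≟_ L f k <ᶻ 0ℤ) → ∃[ k ] k ∉ L × f k <ᶻ 0ℤ
  unmask (k , fk<0) with k ∈? L
  ... | yes _ = contradiction fk<0 λ { (+<+ ()) }
  ... | no k∉L = k , k∉L , fk<0

sumℤ-++ : ∀ xs ys → sumℤ (xs ++ ys) ≡ sumℤ xs + sumℤ ys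
sumℤ-++ []       ys = sym (ℤₚ.+-identityˡ _)
sumℤ-++ (x ∷ xs) ys = trans (cong (_+_ x) (sumℤ-++ xs ys)) (sym (ℤₚ.+-assoc x _ _))

sumℤ-tabulate : ∀ {n} (f : Fin n → ℤ) → sumℤ (tabulate f) ≡ sum f
sumℤ-tabulate {zero}  f = refl
sumℤ-tabulate {suc n} f = cong (_+_ (f zero)) (sumℤ-tabulate (f ∘ suc))

sumℤ-allFin : ∀ {n} (f : Fin n → ℤ) → sumℤ (map f (allFin n)) ≡ sum f
sumℤ-allFin f = trans (cong sumℤ (map-tabulate id f)) (sumℤ-tabulate f)

sumℤ-concatMap : ∀ {A B : Set} (f : B → ℤ) (g : A → List B) xs →
                 sumℤ (map f (concatMap g xs)) ≡ sumℤ (map (λ a → sumℤ (map f (g a))) xs)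
sumℤ-concatMap f g []       = refl
sumℤ-concatMap f g (x ∷ xs) = begin
  sumℤ (map f (g x ++ concatMap g xs))                   ≡⟨ cong sumℤ (map-++ f (g x) _) ⟩
  sumℤ (map f (g x) ++ map f (concatMap g xs))           ≡⟨ sumℤ-++ (map f (g x)) _ ⟩
  sumℤ (map f (g x)) + sumℤ
      (map f (concatMap g xs))     ≡⟨ cong (_+_ (sumℤ (map f (g x)))) (sumℤ-concatMap f g xs) ⟩
  sumℤ (map f (g x)) + sumℤ (map (λ a → sumℤ (map f (g a))) xs) ∎
  where open ≡-Reasoning

-- Equality of games and sums over all games

IsB-irrelevant : ∀ Φ (p q : IsB Φ) → p ≡ q
IsB-irrelevant B p q = refl

IsC-irrelevant : ∀ Φ (p q : IsC Φ) → p ≡ q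
IsC-irrelevant C p q = refl

neg-cong : ∀ {Φ n} {i i′ j j′ : Fin n} (p : j < i) (q : j′ < i′) → i ≡ i′ → j ≡ j′ →
    neg {Φ} i j p ≡ neg i′ j′ q
neg-cong p q refl refl = cong (neg _ _) (F.<-irrelevant p q)

pos-cong : ∀ {Φ n} {i i′ j j′ : Fin n} (p : j < i) (q : j′ < i′) → i ≡ i′ → j ≡ j′ →
    pos {Φ} i j p ≡ pos i′ j′ q
pos-cong p q refl refl = cong (pos _ _) (F.<-irrelevant p q)

_≟ᴱ_ : ∀ {Φ n} → DecidableEquality (Edge Φ n)
neg i j p ≟ᴱ neg i′ j′ q with i F.≟ i′ | j F.≟ j′
... | yes i≡ | yes j≡ = yes (neg-cong p q i≡ j≡)
... | no i≢  | _      = no λ { refl → i≢ refl }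
... | _      | no j≢  = no λ { refl → j≢ refl }
pos i j p ≟ᴱ pos i′ j′ q with i F.≟ i′ | j F.≟ j′
... | yes i≡ | yes j≡ = yes (pos-cong p q i≡ j≡)
... | no i≢  | _      = no λ { refl → i≢ refl }
... | _      | no j≢  = no λ { refl → j≢ refl }
_≟ᴱ_ {Φ} (half i p) (half j q) =
    map′ (λ { refl → cong (half i) (IsB-irrelevant Φ p q) }) (λ { refl → refl }) (i F.≟ j)
_≟ᴱ_ {Φ} (loop i p) (loop j q) =
    map′ (λ { refl → cong (loop i) (IsC-irrelevant Φ p q) }) (λ { refl → refl }) (i F.≟ j)
neg _ _ _ ≟ᴱ pos _ _ _ = no λ ()
neg _ _ _ ≟ᴱ half _ _  = no λ ()
neg _ _ _ ≟ᴱ loop _ _  = no λ ()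
pos _ _ _ ≟ᴱ neg _ _ _ = no λ ()
pos _ _ _ ≟ᴱ half _ _  = no λ ()
pos _ _ _ ≟ᴱ loop _ _  = no λ ()
half _ _  ≟ᴱ neg _ _ _ = no λ ()
half _ _  ≟ᴱ pos _ _ _ = no λ ()
half _ _  ≟ᴱ loop _ _  = no λ ()
loop _ _  ≟ᴱ neg _ _ _ = no λ ()
loop _ _  ≟ᴱ pos _ _ _ = no λ ()
loop _ _  ≟ᴱ half _ _  = no λ ()

-- The default 0 makes a sum over all ordered pairs count each unordered pair once.
pairTerm : ∀ {Φ n} → (Edge Φ n → ℤ) → Fin n → Fin n → ℤ
pairTerm φ i j with j <? i
... | yes p = φ (neg i j p) + φ (pos i j p)
... | no _  = 0ℤ

extraTerm : ∀ {Φ n} → (Edge Φ n → ℤ) → Fin n → ℤ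
extraTerm {B} φ i = φ (half i tt)
extraTerm {C} φ i = φ (loop i tt)
extraTerm {D} φ i = 0ℤ

sumᴱ : ∀ {Φ n} → (Edge Φ n → ℤ) → ℤ
sumᴱ {Φ} {n} φ = sumℤ (map φ (allEdges Φ n))

sumᴱ-decompose : ∀ {Φ n} (φ : Edge Φ n → ℤ) →
                 sumᴱ φ ≡ sum (λ i → sum (pairTerm φ i)) + sum (extraTerm φ)
sumᴱ-decompose {Φ} {n} φ = begin
  sumℤ (map φ (ps ++ halfEdges Φ n ++ loopEdges Φ n))           ≡⟨ cong sumℤ (map-++ φ ps _) ⟩
  sumℤ (map φ ps ++ map φ (halfEdges Φ n ++ loopEdges Φ n))     ≡⟨ sumℤ-++ (map φ ps) _ ⟩
  sumℤ (map φ ps) + sumℤ (map φ (halfEdges Φ n ++ loopEdges Φ n)) ≡⟨ cong₂ _+_ pairs (extras Φ φ) ⟩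
  sum (λ i → sum (pairTerm φ i)) + sum (extraTerm φ)            ∎
  where
  open ≡-Reasoning
  ps = concatMap (λ i → concatMap (λ j → pairEdges i j) (allFin n)) (allFin n)
  pair : ∀ i j → sumℤ (map φ (pairEdges i j)) ≡ pairTerm φ i j
  pair i j with j <? i
  ... | yes p = cong (_+_ (φ (neg i j p))) (ℤₚ.+-identityʳ (φ (pos i j p)))
  ... | no _ = refl
  pairs : sumℤ (map φ ps) ≡ sum (λ i → sum (pairTerm φ i))
  pairs = trans (sumℤ-concatMap φ _ (allFin n)) (trans (sumℤ-allFin {n} _)
    (sum-cong-≗ λ i → trans (sumℤ-concatMap φ (pairEdges i) (allFin n))
        (trans (sumℤ-allFin {n} _) (sum-cong-≗ (pair i)))))
  extras : ∀ Φ (φ : Edge Φ n → ℤ) → sumℤ (map φ (halfEdges Φ n ++ loopEdges Φ n)) ≡ sum (extraTerm φ)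
  extras B φ = trans (cong sumℤ (trans (map-++ φ (halfEdges B n) [])
      (trans (++-identityʳ _) (sym (map-∘ (allFin n)))))) (sumℤ-allFin {n} _)
  extras C φ = trans (cong sumℤ (sym (map-∘ (allFin n)))) (sumℤ-allFin {n} _)
  extras D φ = sym (sum-zero {n} λ _ → refl)

pairTerm-zero : ∀ {Φ n} (f : Edge Φ n → ℤ) i j → (∀ p → f (neg i j p) ≡ 0ℤ) →
    (∀ p → f (pos i j p) ≡ 0ℤ) → pairTerm f i j ≡ 0ℤ
pairTerm-zero f i j f⁻ f⁺ with j <? i
... | yes p = cong₂ _+_ (f⁻ p) (f⁺ p)
... | no _  = refl

-- The content is in `S-point`: every game occurs exactly once in `allEdges`.
sumᴱ-isSummation : ∀ {Φ n} → IsSummation _≟ᴱ_ (sumᴱ {Φ} {n})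
sumᴱ-isSummation {Φ} {n} =
    record { S-cong = λ eq → cong sumℤ (map-cong eq (allEdges Φ n)) ; S-+ = λ f g →
    additive f g (allEdges Φ n) ; S-point = point }
  where
  additive : ∀ (f g : Edge Φ n → ℤ) es →
             sumℤ (map (λ e → f e + g e) es) ≡ sumℤ (map f es) + sumℤ (map g es)
  additive f g []       = refl
  additive f g (e ∷ es) =
      trans (cong (_+_ (f e + g e)) (additive f g es))
      (interchange (f e) (g e) (sumℤ (map f es)) (sumℤ (map g es)))

  extra-zero : ∀ Φ (f : Edge Φ n → ℤ) → (∀ i p → f (half i p) ≡ 0ℤ) → (∀ i p → f (loop i p) ≡ 0ℤ) →
      ∀ i → extraTerm f i ≡ 0ℤ
  extra-zero B f fʰ fˡ i = fʰ i tt
  extra-zero C f fʰ fˡ i = fˡ i tt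
  extra-zero D f fʰ fˡ i = refl

  pairs-only : ∀ (f : Edge Φ n → ℤ) → (∀ i p → f (half i p) ≡ 0ℤ) → (∀ i p → f (loop i p) ≡ 0ℤ) →
      ∀ i j →
               (∀ i′ j′ p → ¬ (i′ ≡ i × j′ ≡ j) → f (neg i′ j′ p) ≡ 0ℤ) →
               (∀ i′ j′ p → ¬ (i′ ≡ i × j′ ≡ j) → f (pos i′ j′ p) ≡ 0ℤ) →
               sumᴱ f ≡ pairTerm f i j
  pairs-only f fʰ fˡ i j f⁻ f⁺ = begin
    sumᴱ f                                              ≡⟨ sumᴱ-decompose f ⟩
    sum (λ i → sum (pairTerm f i)) + sum
        (extraTerm f)  ≡⟨ cong (_+_ (sum (λ i → sum (pairTerm f i))))
        (sum-zero (extra-zero Φ f fʰ fˡ)) ⟩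
    sum (λ i → sum (pairTerm f i)) + 0ℤ                 ≡⟨ ℤₚ.+-identityʳ _ ⟩
    sum (λ i → sum (pairTerm f i))                      ≡⟨ sum-point _ i
        (λ i′ i′≢ → sum-zero λ j′ →
        pairTerm-zero f i′ j′ (λ p → f⁻ i′ j′ p (i′≢ ∘ proj₁)) (λ p → f⁺ i′ j′ p (i′≢ ∘ proj₁))) ⟩
    sum (pairTerm f i)                                  ≡⟨ sum-point _ j
        (λ j′ j′≢ → pairTerm-zero f i j′ (λ p → f⁻ i j′ p (j′≢ ∘ proj₂))
        (λ p → f⁺ i j′ p (j′≢ ∘ proj₂))) ⟩
    pairTerm f i j                                      ∎
    where open ≡-Reasoning

  extra-only : ∀ (f : Edge Φ n → ℤ) i → (∀ i′ j′ p → f (neg i′ j′ p) ≡ 0ℤ) →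
      (∀ i′ j′ p → f (pos i′ j′ p) ≡ 0ℤ) →
               (∀ i′ → i′ ≢ i → extraTerm f i′ ≡ 0ℤ) → sumᴱ f ≡ extraTerm f i
  extra-only f i f⁻ f⁺ f≡0 = trans (sumᴱ-decompose f) (trans
    (cong₂ _+_ (sum-zero λ i′ → sum-zero λ j′ → pairTerm-zero f i′ j′ (f⁻ i′ j′) (f⁺ i′ j′))
        (sum-point _ i f≡0))
    (ℤₚ.+-identityˡ _))

  point : ∀ (f : Edge Φ n → ℤ) e → (∀ e′ → e′ ≢ e → f e′ ≡ 0ℤ) → sumᴱ f ≡ f e
  point f (neg i j p) f≡0 = trans (pairs-only f (λ _ _ → f≡0 _ λ ()) (λ _ _ → f≡0 _ λ ()) i j
    (λ i′ j′ q ≢ij → f≡0 _ λ { refl → ≢ij (refl , refl) }) (λ _ _ _ _ → f≡0 _ λ ())) at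
    where
    at : pairTerm f i j ≡ f (neg i j p)
    at with j <? i
    ... | yes q = trans (cong₂ _+_ (cong f (neg-cong q p refl refl)) (f≡0 (pos i j q) λ ()))
        (ℤₚ.+-identityʳ _)
    ... | no ¬p = contradiction p ¬p
  point f (pos i j p) f≡0 = trans (pairs-only f (λ _ _ → f≡0 _ λ ()) (λ _ _ → f≡0 _ λ ()) i j
    (λ _ _ _ _ → f≡0 _ λ ()) (λ i′ j′ q ≢ij → f≡0 _ λ { refl → ≢ij (refl , refl) })) at
    where
    at : pairTerm f i j ≡ f (pos i j p)
    at with j <? i
    ... | yes q = trans (cong₂ _+_ (f≡0 (neg i j q) λ ()) (cong f (pos-cong q p refl refl)))
        (ℤₚ.+-identityˡ _)
    ... | no ¬p = contradiction p ¬p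
  point f (half i p) f≡0 = go Φ refl f p f≡0
    where
    go : ∀ Ψ → Ψ ≡ Φ → (f : Edge Φ n → ℤ) (p : IsB Φ) → (∀ e′ → e′ ≢ half i p → f e′ ≡ 0ℤ) →
        sumᴱ f ≡ f (half i p)
    go B refl f tt f≡0 =
        extra-only f i (λ _ _ _ → f≡0 _ λ ()) (λ _ _ _ → f≡0 _ λ ())
        (λ i′ i′≢i → f≡0 _ λ { refl → i′≢i refl })
    go C refl f ()
    go D refl f ()
  point f (loop i p) f≡0 = go Φ refl f p f≡0
    where
    go : ∀ Ψ → Ψ ≡ Φ → (f : Edge Φ n → ℤ) (p : IsC Φ) → (∀ e′ → e′ ≢ loop i p → f e′ ≡ 0ℤ) →
        sumᴱ f ≡ f (loop i p)
    go C refl f tt f≡0 =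
        extra-only f i (λ _ _ _ → f≡0 _ λ ()) (λ _ _ _ → f≡0 _ λ ())
        (λ i′ i′≢i → f≡0 _ λ { refl → i′≢i refl })
    go B refl f ()
    go D refl f ()

-- Moves preserve the score

genShape-unique : ∀ {Φ n} {G : List (Edge Φ n)} → GenShape G → Unique G
genShape-unique (triNeg a b c ab ac bc) =
  ((λ { refl → F.<⇒≢ bc refl }) ∷ (λ { refl → F.<⇒≢ ab refl }) ∷ []) ∷
      ((λ { refl → F.<⇒≢ ab refl }) ∷ []) ∷ [] ∷ []
genShape-unique (triMix₁ a b c ab ac bc) =
    ((λ ()) ∷ (λ ()) ∷ []) ∷ ((λ { refl → F.<⇒≢ ab refl }) ∷ []) ∷ [] ∷ []
genShape-unique (triMix₂ a b c ab ac bc) =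
    ((λ ()) ∷ (λ { refl → F.<⇒≢ ab refl }) ∷ []) ∷ ((λ ()) ∷ []) ∷ [] ∷ []
genShape-unique (triMix₃ a b c ab ac bc) =
    ((λ { refl → F.<⇒≢ bc refl }) ∷ (λ ()) ∷ []) ∷ ((λ ()) ∷ []) ∷ [] ∷ []
genShape-unique (halfNeg a b ab h) =
    ((λ ()) ∷ (λ ()) ∷ []) ∷ ((λ { refl → F.<⇒≢ ab refl }) ∷ []) ∷ [] ∷ []
genShape-unique (halfPos a b ab h) =
    ((λ ()) ∷ (λ ()) ∷ []) ∷ ((λ { refl → F.<⇒≢ ab refl }) ∷ []) ∷ [] ∷ []
genShape-unique (clover₁ a b ab h) = ((λ ()) ∷ (λ ()) ∷ []) ∷ ((λ ()) ∷ []) ∷ [] ∷ []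
genShape-unique (clover₂ a b ab h) = ((λ ()) ∷ (λ ()) ∷ []) ∷ ((λ ()) ∷ []) ∷ [] ∷ []

sgn-not : ∀ b → sgn (not b) ≡ - sgn b
sgn-not true  = refl
sgn-not false = refl

twiceSum-flipped : ∀ {Φ n} {T U : Tournament Φ n} G k → (∀ e → e ∈ G → U e ≡ not (T e)) →
                   twiceSum U G k ≡ - twiceSum T G k
twiceSum-flipped []      k eq = refl
twiceSum-flipped {T = T} {U} (e ∷ G) k eq = begin
  sgn (U e) * vec e k + twiceSum U G
      k       ≡⟨ cong₂ (λ b s → sgn b * vec e k + s) (eq e (here refl))
      (twiceSum-flipped G k λ e′ → eq e′ ∘ there) ⟩
  sgn (not (T e)) * vec e k - twiceSum T G k
      ≡⟨ cong (λ s → s * vec e k - twiceSum T G k) (sgn-not (T e)) ⟩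
  - sgn (T e) * vec e k - twiceSum T G k     ≡⟨ lemma (sgn (T e)) (vec e k) (twiceSum T G k) ⟩
  - (sgn (T e) * vec e k + twiceSum T G k)   ∎
  where
  open ≡-Reasoning
  lemma : ∀ a b c → - a * b - c ≡ - (a * b + c)
  lemma = solve-∀

-- The change is supported on the games of the generator. These are distinct, so it equals minus
-- twice their sum, which is zero by neutrality.
step-score : ∀ {Φ n} {T U : Tournament Φ n} → Step T U → ∀ k → twiceScore U k ≡ twiceScore T k
step-score {Φ} {n} {T} {U} (G , shape , neutral , flips) k = begin
  sumᴱ φᵁ                      ≡⟨ S-cong (λ e → sym (cancel (φᵀ e) (φᵁ e))) ⟩
  sumᴱ (λ e → φᵀ e + diff e)   ≡⟨ S-+ φᵀ diff ⟩
  sumᴱ φᵀ + sumᴱ diff          ≡⟨ cong (_+_ (sumᴱ φᵀ))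
      (trans (S-support diff (genShape-unique shape) off) (trans (on G) balanced)) ⟩
  sumᴱ φᵀ + 0ℤ                 ≡⟨ ℤₚ.+-identityʳ _ ⟩
  sumᴱ φᵀ                      ∎
  where
  open ≡-Reasoning
  open IsSummation (sumᴱ-isSummation {Φ} {n})
  φᵀ φᵁ diff : Edge Φ n → ℤ
  φᵀ e = sgn (T e) * vec e k
  φᵁ e = sgn (U e) * vec e k
  diff e = φᵁ e - φᵀ e
  cancel : ∀ a b → a + (b - a) ≡ b
  cancel = solve-∀
  off : ∀ e → e ∉ G → diff e ≡ 0ℤ
  off e e∉G rewrite proj₂ (flips e) e∉G = ℤₚ.+-inverseʳ (φᵀ e)
  on : ∀ L → sumℤ (map diff L) ≡ twiceSum U L k - twiceSum T L k
  on [] = refl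
  on (e ∷ L) = trans (cong (_+_ (diff e)) (on L))
      (lemma (φᵁ e) (φᵀ e) (twiceSum U L k) (twiceSum T L k))
    where
    lemma : ∀ a b c d → a - b + (c - d) ≡ a + c - (b + d)
    lemma = solve-∀
  balanced : twiceSum U G k - twiceSum T G k ≡ 0ℤ
  balanced rewrite twiceSum-flipped {T = T} {U} G k (λ e → proj₁ (flips e)) | neutral k = refl

-- Signed vertices and games read as arcs

-- Multiplication of signs, with `true` as plus.
same : Bool → Bool → Bool
same b true  = b
same b false = not b

same-comm : ∀ a b → same a b ≡ same b a
same-comm true  true  = refl
same-comm true  false = refl
same-comm false true  = refl
same-comm false false = refl

same-notʳ : ∀ a b → same a (not b) ≡ not (same a b)
same-notʳ a true  = refl
same-notʳ a false = sym (𝔹.not-involutive a)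

same-notˡ : ∀ a b → same (not a) b ≡ not (same a b)
same-notˡ a true  = refl
same-notˡ a false = refl

same-skew : ∀ a b → same b (not a) ≡ same a (not b)
same-skew a b = trans (same-notʳ b a) (trans (cong not (same-comm b a)) (sym (same-notʳ a b)))

same-true : ∀ {a b} → same a b ≡ true → a ≡ b
same-true {true}  {true}  _ = refl
same-true {false} {false} _ = refl

Signed : ℕ → Set
Signed n = Fin n × Bool

base : ∀ {n} → Signed n → Fin n
base x = proj₁ x

~_ : ∀ {n} → Signed n → Signed n
~ (i , σ) = i , not σ

infix 8 ~_

unit : ∀ {n} → Signed n → Fin n → ℤ
unit (i , σ) k = sgn σ * δ i k

orient : ∀ {n} (x y : Signed n) → Bool
orient (i , σ) (j , τ) with F.<-cmp i j
... | tri< _ _ _ = not τ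
... | tri≈ _ _ _ = σ
... | tri> _ _ _ = σ

module _ {Φ : CoxType} {n : ℕ} where

  pairEdge : Bool → (i j : Fin n) → j < i → Edge Φ n
  pairEdge true  = neg
  pairEdge false = pos

  -- Equal signs give a negative edge, because x - y is then plus or minus a difference of basis
  -- vectors. The inequality is irrelevant, so that different proofs of it name the same game.
  arcEdge : (x y : Signed n) → .(base x ≢ base y) → Edge Φ n
  arcEdge (i , σ) (j , τ) i≢j with F.<-cmp i j
  ... | tri< i<j _ _ = pairEdge (same σ τ) j i i<j
  ... | tri≈ _ i≡j _ = Irrelevant.⊥-elim (i≢j i≡j)
  ... | tri> _ _ j<i = pairEdge (same σ τ) i j j<i

  pairEdge-cong : ∀ {b b′ i j} (p q : j < i) → b ≡ b′ → pairEdge b i j p ≡ pairEdge b′ i j q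
  pairEdge-cong {b} {i = i} {j} p q refl = cong (pairEdge b i j) (F.<-irrelevant p q)

  arcEdge-> : ∀ {i j} σ τ (j<i : j < i) .(i≢j : i ≢ j) →
      arcEdge (i , σ) (j , τ) i≢j ≡ pairEdge (same σ τ) i j j<i
  arcEdge-> {i} {j} σ τ j<i i≢j with F.<-cmp i j
  ... | tri< i<j _ _ = contradiction j<i (F.<-asym i<j)
  ... | tri≈ _ i≡j _ = Irrelevant.⊥-elim (i≢j i≡j)
  ... | tri> _ _ q = pairEdge-cong q j<i refl

  arcEdge-< : ∀ {i j} σ τ (i<j : i < j) .(i≢j : i ≢ j) →
      arcEdge (i , σ) (j , τ) i≢j ≡ pairEdge (same σ τ) j i i<j
  arcEdge-< {i} {j} σ τ i<j i≢j with F.<-cmp i j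
  ... | tri< q _ _ = pairEdge-cong q i<j refl
  ... | tri≈ _ i≡j _ = Irrelevant.⊥-elim (i≢j i≡j)
  ... | tri> _ _ j<i = contradiction j<i (F.<-asym i<j)

  arcEdge-sym : ∀ x y .(p : base x ≢ base y) .(q : base y ≢ base x) → arcEdge y x q ≡ arcEdge x y p
  arcEdge-sym (i , σ) (j , τ) p q with F.<-cmp i j
  ... | tri< i<j _ _ = trans (arcEdge-> τ σ i<j q) (pairEdge-cong i<j i<j (same-comm τ σ))
  ... | tri≈ _ i≡j _ = Irrelevant.⊥-elim (p i≡j)
  ... | tri> _ _ j<i = trans (arcEdge-< τ σ j<i q) (pairEdge-cong j<i j<i (same-comm τ σ))

  orient-sym : ∀ (x y : Signed n) → base x ≢ base y → orient y x ≡ not (orient x y)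
  orient-sym (i , σ) (j , τ) i≢j with F.<-cmp i j | F.<-cmp j i
  ... | tri< _ _ _ | tri> _ _ _ = sym (𝔹.not-involutive τ)
  ... | tri> _ _ _ | tri< _ _ _ = refl
  ... | tri< i<j _ _ | tri< j<i _ _ = contradiction j<i (F.<-asym i<j)
  ... | tri> _ _ j<i | tri> _ _ i<j = contradiction j<i (F.<-asym i<j)
  ... | tri≈ _ i≡j _ | _ = contradiction i≡j i≢j
  ... | _ | tri≈ _ j≡i _ = contradiction (sym j≡i) i≢j

  -- Both arcs stand for x + y. Thus each game can also be read as the reversed arc between the
  -- negated vertices.
  arcEdge-skew : ∀ x y .(p : base x ≢ base y) .(q : base y ≢ base x) →
      arcEdge y (~ x) q ≡ arcEdge x (~ y) p
  arcEdge-skew (i , σ) (j , τ) p q with F.<-cmp i j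
  ... | tri< i<j _ _ = trans (arcEdge-> τ (not σ) i<j q) (pairEdge-cong i<j i<j (same-skew σ τ))
  ... | tri≈ _ i≡j _ = Irrelevant.⊥-elim (p i≡j)
  ... | tri> _ _ j<i = trans (arcEdge-< τ (not σ) j<i q) (pairEdge-cong j<i j<i (same-skew σ τ))

  orient-skew : ∀ (x y : Signed n) → base x ≢ base y → orient y (~ x) ≡ orient x (~ y)
  orient-skew (i , σ) (j , τ) i≢j with F.<-cmp i j | F.<-cmp j i
  ... | tri< _ _ _ | tri> _ _ _ = sym (𝔹.not-involutive τ)
  ... | tri> _ _ _ | tri< _ _ _ = 𝔹.not-involutive σ
  ... | tri< i<j _ _ | tri< j<i _ _ = contradiction j<i (F.<-asym i<j)
  ... | tri> _ _ j<i | tri> _ _ i<j = contradiction j<i (F.<-asym i<j)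
  ... | tri≈ _ i≡j _ | _ = contradiction i≡j i≢j
  ... | _ | tri≈ _ j≡i _ = contradiction (sym j≡i) i≢j

  arcEdge-vec : ∀ x y (p : base x ≢ base y) k →
      sgn (orient x y) * vec (arcEdge x y p) k ≡ unit x k - unit y k
  arcEdge-vec (i , σ) (j , τ) p k with F.<-cmp i j
  ... | tri≈ _ i≡j _ = contradiction i≡j p
  ... | tri< i<j _ _ = lower σ τ
    where
    lower : ∀ σ τ → sgn (not τ) * vec (pairEdge (same σ τ) j i i<j) k ≡ unit (i , σ) k - unit (j , τ) k
    lower true true = lemma (δ i k) (δ j k)
      where
      lemma : ∀ a b → -[1+ 0 ] * (b - a) ≡ + 1 * a - + 1 * b
      lemma = solve-∀
    lower true false = lemma (δ i k) (δ j k)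
      where
      lemma : ∀ a b → + 1 * (b + a) ≡ + 1 * a - -[1+ 0 ] * b
      lemma = solve-∀
    lower false true = lemma (δ i k) (δ j k)
      where
      lemma : ∀ a b → -[1+ 0 ] * (b + a) ≡ -[1+ 0 ] * a - + 1 * b
      lemma = solve-∀
    lower false false = lemma (δ i k) (δ j k)
      where
      lemma : ∀ a b → + 1 * (b - a) ≡ -[1+ 0 ] * a - -[1+ 0 ] * b
      lemma = solve-∀
  ... | tri> _ _ j<i = upper σ τ
    where
    upper : ∀ σ τ → sgn σ * vec (pairEdge (same σ τ) i j j<i) k ≡ unit (i , σ) k - unit (j , τ) k
    upper true true = lemma (δ i k) (δ j k)
      where
      lemma : ∀ a b → + 1 * (a - b) ≡ + 1 * a - + 1 * b
      lemma = solve-∀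
    upper true false = lemma (δ i k) (δ j k)
      where
      lemma : ∀ a b → + 1 * (a + b) ≡ + 1 * a - -[1+ 0 ] * b
      lemma = solve-∀
    upper false true = lemma (δ i k) (δ j k)
      where
      lemma : ∀ a b → -[1+ 0 ] * (a + b) ≡ -[1+ 0 ] * a - + 1 * b
      lemma = solve-∀
    upper false false = lemma (δ i k) (δ j k)
      where
      lemma : ∀ a b → -[1+ 0 ] * (a - b) ≡ -[1+ 0 ] * a - -[1+ 0 ] * b
      lemma = solve-∀

  Touches : Edge Φ n → Fin n → Set
  Touches (neg i j _) u = u ≡ i ⊎ u ≡ j
  Touches (pos i j _) u = u ≡ i ⊎ u ≡ j
  Touches (half i _)  u = u ≡ i
  Touches (loop i _)  u = u ≡ i

  pairEdge-touches : ∀ b {i j u} (p : j < i) → u ≡ i ⊎ u ≡ j → Touches (pairEdge b i j p) u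
  pairEdge-touches true  p t = t
  pairEdge-touches false p t = t

  pairEdge-touched : ∀ b {i j u} (p : j < i) → Touches (pairEdge b i j p) u → u ≡ i ⊎ u ≡ j
  pairEdge-touched true  p t = t
  pairEdge-touched false p t = t

  arcEdge-touches : ∀ x y (p : base x ≢ base y) {u} → u ≡ base x ⊎ u ≡ base y →
      Touches (arcEdge x y p) u
  arcEdge-touches (i , σ) (j , τ) p t with F.<-cmp i j
  ... | tri< i<j _ _ = pairEdge-touches (same σ τ) i<j (Sum.swap t)
  ... | tri≈ _ i≡j _ = contradiction i≡j p
  ... | tri> _ _ j<i = pairEdge-touches (same σ τ) j<i t

  arcEdge-touched : ∀ x y (p : base x ≢ base y) {u} → Touches (arcEdge x y p) u →
      u ≡ base x ⊎ u ≡ base y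
  arcEdge-touched (i , σ) (j , τ) p t with F.<-cmp i j
  ... | tri< i<j _ _ = Sum.swap (pairEdge-touched (same σ τ) i<j t)
  ... | tri≈ _ i≡j _ = contradiction i≡j p
  ... | tri> _ _ j<i = pairEdge-touched (same σ τ) j<i t

  -- The game between x and y contributes the vector x − y.
  opaque
    beats : Tournament Φ n → (x y : Signed n) → .(base x ≢ base y) → Bool
    beats T x y p = same (T (arcEdge x y p)) (orient x y)

  opaque
    unfolding beats

    beats-def : ∀ T x y .(p : base x ≢ base y) → beats T x y p ≡ same (T (arcEdge x y p)) (orient x y)
    beats-def T x y p = refl

    beats-sym : ∀ T x y (p : base x ≢ base y) (q : base y ≢ base x) →
        beats T y x q ≡ not (beats T x y p)
    beats-sym T x y p q =
        trans (cong₂ same (cong T (arcEdge-sym x y p q)) (orient-sym x y p))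
        (same-notʳ (T (arcEdge x y p)) (orient x y))

    beats-skew : ∀ T x y (p : base x ≢ base y) (q : base y ≢ base x) →
        beats T y (~ x) q ≡ beats T x (~ y) p
    beats-skew T x y p q = cong₂ same (cong T (arcEdge-skew x y p q)) (orient-skew x y p)

    beats-not : ∀ {T U x y} .(p : base x ≢ base y) → U (arcEdge x y p) ≡ not (T (arcEdge x y p)) →
        beats U x y p ≡ not (beats T x y p)
    beats-not {T} {U} {x} {y} p eq =
        trans (cong (λ b → same b (orient x y)) eq) (same-notˡ (T (arcEdge x y p)) (orient x y))

    beats-cong : ∀ {T U} x y .(p : base x ≢ base y) → U (arcEdge x y p) ≡ T (arcEdge x y p) →
        beats U x y p ≡ beats T x y p
    beats-cong x y p eq = cong (λ b → same b (orient x y)) eq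

    beats-injective : ∀ {T U} x y .(p : base x ≢ base y) → beats T x y p ≡ beats U x y p →
        T (arcEdge x y p) ≡ U (arcEdge x y p)
    beats-injective {T} {U} x y p = cancel _ _ (orient x y)
      where
      cancel : ∀ a b o → same a o ≡ same b o → a ≡ b
      cancel a b true  eq = eq
      cancel a b false eq = 𝔹.not-injective eq

    beats-vec : ∀ {T} x y (p : base x ≢ base y) → beats T x y p ≡ true → ∀ k →
                sgn (T (arcEdge x y p)) * vec (arcEdge x y p) k ≡ unit x k - unit y k
    beats-vec {T} x y p won k =
        trans (cong (λ b → sgn b * vec (arcEdge x y p) k)
        (same-true {T (arcEdge x y p)} {orient x y} won)) (arcEdge-vec x y p k)

-- Scores as row sums

weight : CoxType → ℤ
weight B = + 1
weight C = + 2
weight D = + 0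

-- The value in type D, which has neither half edges nor loops, is junk; it always carries weight 0.
extraBit : ∀ {Φ n} → Tournament Φ n → Fin n → Bool
extraBit {B} T i = T (half i tt)
extraBit {C} T i = T (loop i tt)
extraBit {D} T i = true

module _ {Φ : CoxType} {n : ℕ} where

  extra : Tournament Φ n → Signed n → ℤ
  extra T (i , σ) = weight Φ * sgn (same (extraBit T i) σ)

  -- Entry `k` collects the two games between `base x` and `k`; the diagonal, where there are none,
  -- holds the half edge or loop.
  row : Tournament Φ n → Signed n → Fin n → ℤ
  row T x k with base x F.≟ k
  ... | yes _ = extra T x
  ... | no  p = sgn (beats T x (k , true) p) + sgn (beats T x (k , false) p)

  row-self : ∀ T x → row T x (base x) ≡ extra T x
  row-self T x with base x F.≟ base x
  ... | yes _ = refl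
  ... | no  p = contradiction refl p

  row-other : ∀ T x {k} (p : base x ≢ k) →
      row T x k ≡ sgn (beats T x (k , true) p) + sgn (beats T x (k , false) p)
  row-other T x {k} p with base x F.≟ k
  ... | yes q = contradiction q p
  ... | no  _ = refl

  -- `~ x` beats z exactly when x loses to `~ z`, so the two games at `k` exchange places and change
  -- sign.
  row-~ : ∀ T x k → row T (~ x) k ≡ - row T x k
  row-~ T (i , σ) k with i F.≟ k
  ... | yes _ = trans (cong (λ b → weight Φ * sgn b) (same-notʳ (extraBit T i) σ))
                  (trans (cong (_*_ (weight Φ)) (sgn-not (same (extraBit T i) σ)))
                      (sym (ℤₚ.neg-distribʳ-* (weight Φ) (sgn (same (extraBit T i) σ)))))
  ... | no p = trans (cong₂ (λ a b → sgn a + sgn b) (bit true) (bit false))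
      (flip (beats T (i , σ) (k , false) p) (beats T (i , σ) (k , true) p))
    where
    bit : ∀ τ → beats T (i , not σ) (k , τ) p ≡ not (beats T (i , σ) (k , not τ) p)
    bit τ = trans (beats-sym T (k , τ) (i , not σ) (≢-sym p) p)
        (cong not (beats-skew T (i , σ) (k , τ) p (≢-sym p)))
    flip : ∀ a b → sgn (not a) + sgn (not b) ≡ - (sgn b + sgn a)
    flip true true = refl
    flip true false = refl
    flip false true = refl
    flip false false = refl

δ-refl : ∀ {n} (i : Fin n) → δ i i ≡ 1ℤ
δ-refl i with i F.≟ i
... | yes _ = refl
... | no i≢i = contradiction refl i≢i

δ-≢ : ∀ {n} {i k : Fin n} → i ≢ k → δ i k ≡ 0ℤ
δ-≢ {i = i} {k} i≢k with i F.≟ k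
... | yes i≡k = contradiction i≡k i≢k
... | no _ = refl

sum-δ : ∀ {n} (f : Fin n → ℤ) k → sum (λ i → δ i k * f i) ≡ f k
sum-δ f k = trans (sum-point _ k λ j j≢k → cong (_* f j) (δ-≢ j≢k))
    (trans (cong (_* f k) (δ-refl k)) (ℤₚ.*-identityˡ (f k)))

module _ {Φ : CoxType} {n : ℕ} (T : Tournament Φ n) where
  private
    -- For i > j, the total coefficients with which the two games on the pair enter coordinate i
    -- (`upper`) and coordinate j (`lower`).
    upper lower : Fin n → Fin n → ℤ
    upper i j = pairTerm (λ e → sgn (T e)) i j
    lower i j with j <? i
    ... | yes p = sgn (T (pos i j p)) - sgn (T (neg i j p))
    ... | no _  = 0ℤ

    term : Fin n → Edge Φ n → ℤ
    term k e = sgn (T e) * vec e k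

    pairTerm-split : ∀ k i j → pairTerm (term k) i j ≡ δ i k * upper i j + δ j k * lower i j
    pairTerm-split k i j with j <? i
    ... | yes p = lemma (sgn (T (neg i j p))) (sgn (T (pos i j p))) (δ i k) (δ j k)
      where
      lemma : ∀ s t a b → s * (a - b) + t * (a + b) ≡ a * (s + t) + b * (t - s)
      lemma = solve-∀
    ... | no _  = lemma (δ i k) (δ j k)
      where
      lemma : ∀ a b → 0ℤ ≡ a * 0ℤ + b * 0ℤ
      lemma = solve-∀

    extraTerm-split : ∀ k i → extraTerm (term k) i ≡ δ i k * extra T (i , true)
    extraTerm-split k i = go Φ T
      where
      go : ∀ Φ (T : Tournament Φ n) →
          extraTerm (λ e → sgn (T e) * vec e k) i ≡ δ i k * extra T (i , true)
      go B T = lemma (δ i k) (sgn (T (half i tt)))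
        where
        lemma : ∀ a s → s * a ≡ a * (+ 1 * s)
        lemma = solve-∀
      go C T = lemma (δ i k) (sgn (T (loop i tt)))
        where
        lemma : ∀ a s → s * (+ 2 * a) ≡ a * (+ 2 * s)
        lemma = solve-∀
      go D T = sym (ℤₚ.*-zeroʳ (δ i k))

    row-split : ∀ k m → upper k m + lower m k + δ m k * extra T (k , true) ≡ row T (k , true) m
    row-split k m with F.<-cmp k m
    ... | tri≈ _ refl _ =
        trans (cong₂ _+_ (cong₂ _+_ upper≡0 lower≡0)
        (trans (cong (_* extra T (k , true)) (δ-refl k)) (ℤₚ.*-identityˡ _)))
                            (trans (ℤₚ.+-identityˡ _) (sym (row-self T (k , true))))
      where
      upper≡0 : upper k k ≡ 0ℤ
      upper≡0 with k <? k
      ... | yes p = contradiction refl (F.<⇒≢ p)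
      ... | no _ = refl
      lower≡0 : lower k k ≡ 0ℤ
      lower≡0 with k <? k
      ... | yes p = contradiction refl (F.<⇒≢ p)
      ... | no _ = refl
    ... | tri< k<m k≢m _ =
        trans (cong₂ _+_ (cong₂ _+_ upper≡0 lower≡) (cong (_* extra T (k , true)) (δ-≢ (≢-sym k≢m))))
        (trans (shuffle (sgn (T (pos m k k<m))) (sgn (T (neg m k k<m))) (extra T (k , true)))
        (trans (cong₂ _+_ (trans (sym (sgn-not (T (neg m k k<m)))) (cong sgn (bit true)))
            (cong sgn (bit false)))
        (sym (row-other T (k , true) k≢m))))
      where
      shuffle : ∀ a b c → 0ℤ + (a - b) + 0ℤ * c ≡ - b + a
      shuffle = solve-∀
      upper≡0 : upper k m ≡ 0ℤ
      upper≡0 with m <? k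
      ... | yes p = contradiction p (F.<-asym k<m)
      ... | no _ = refl
      lower≡ : lower m k ≡ sgn (T (pos m k k<m)) - sgn (T (neg m k k<m))
      lower≡ with k <? m
      ... | yes p = cong₂ (λ a b → sgn (T a) - sgn (T b)) (pos-cong p k<m refl refl)
          (neg-cong p k<m refl refl)
      ... | no ¬p = contradiction k<m ¬p
      or : ∀ τ → orient (k , true) (m , τ) ≡ not τ
      or τ with F.<-cmp k m
      ... | tri< _ _ _ = refl
      ... | tri≈ _ k≡m _ = contradiction k≡m k≢m
      ... | tri> ¬p _ _ = contradiction k<m ¬p
      bit : ∀ τ → same (T (pairEdge τ m k k<m)) (not τ) ≡ beats T (k , true) (m , τ) k≢m
      bit τ = sym (trans (beats-def T (k , true) (m , τ) k≢m)
          (cong₂ same (cong T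
          (trans (arcEdge-< true τ k<m k≢m) (pairEdge-cong k<m k<m (same-comm true τ)))) (or τ)))
    ... | tri> _ k≢m m<k =
        trans (cong₂ _+_ (cong₂ _+_ upper≡ lower≡0) (cong (_* extra T (k , true)) (δ-≢ (≢-sym k≢m))))
        (trans (shuffle (sgn (T (neg k m m<k))) (sgn (T (pos k m m<k))) (extra T (k , true)))
        (trans (cong₂ _+_ (cong sgn (bit true)) (cong sgn (bit false)))
        (sym (row-other T (k , true) k≢m))))
      where
      shuffle : ∀ a b c → a + b + 0ℤ + 0ℤ * c ≡ a + b
      shuffle = solve-∀
      lower≡0 : lower m k ≡ 0ℤ
      lower≡0 with k <? m
      ... | yes p = contradiction p (F.<-asym m<k)
      ... | no _ = refl
      upper≡ : upper k m ≡ sgn (T (neg k m m<k)) + sgn (T (pos k m m<k))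
      upper≡ with m <? k
      ... | yes p = cong₂ (λ a b → sgn (T a) + sgn (T b)) (neg-cong p m<k refl refl)
          (pos-cong p m<k refl refl)
      ... | no ¬p = contradiction m<k ¬p
      or : ∀ τ → orient (k , true) (m , τ) ≡ true
      or τ with F.<-cmp k m
      ... | tri< _ _ ¬p = contradiction m<k ¬p
      ... | tri≈ _ k≡m _ = contradiction k≡m k≢m
      ... | tri> _ _ _ = refl
      bit : ∀ τ → T (pairEdge τ k m m<k) ≡ beats T (k , true) (m , τ) k≢m
      bit τ = sym (trans (beats-def T (k , true) (m , τ) k≢m)
          (cong₂ same (cong T
          (trans (arcEdge-> true τ m<k k≢m) (pairEdge-cong m<k m<k (same-comm true τ)))) (or τ)))

  row-sum : ∀ k → sum (row T (k , true)) ≡ twiceScore T k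
  row-sum k = sym (begin
    sumᴱ (term k)                                                  ≡⟨ sumᴱ-decompose (term k) ⟩
    sum (λ i → sum (pairTerm (term k) i)) + sum (extraTerm (term k))
      ≡⟨ cong₂ _+_ pairs (trans (sum-cong-≗ (extraTerm-split k)) (sum-δ (λ i → extra T (i , true)) k)) ⟩
    sum (upper k) + sum (λ i → lower i k) + extra T (k , true)
      ≡⟨ cong₂ _+_ (sym (∑-distrib-+ (upper k) (λ i → lower i k)))
          (sym (sum-δ (λ _ → extra T (k , true)) k)) ⟩
    sum (λ m → upper k m + lower m k) + sum (λ m → δ m k * extra T (k , true))
      ≡⟨ sym (∑-distrib-+ (λ m → upper k m + lower m k) (λ m → δ m k * extra T (k , true))) ⟩
    sum (λ m → upper k m + lower m k + δ m k * extra T (k , true)) ≡⟨ sum-cong-≗ (row-split k) ⟩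
    sum (row T (k , true))                                         ∎)
    where
    open ≡-Reasoning
    pairs : sum (λ i → sum (pairTerm (term k) i)) ≡ sum (upper k) + sum (λ i → lower i k)
    pairs = begin
      sum (λ i → sum (pairTerm (term k) i))
        ≡⟨ sum-cong-≗ (λ i →
            trans (sum-cong-≗ (pairTerm-split k i))
            (∑-distrib-+ (λ j → δ i k * upper i j) (λ j → δ j k * lower i j))) ⟩
      sum (λ i → sum (λ j → δ i k * upper i j) + sum (λ j → δ j k * lower i j))
        ≡⟨ ∑-distrib-+ (λ i → sum (λ j → δ i k * upper i j)) (λ i → sum (λ j → δ j k * lower i j)) ⟩
      sum (λ i → sum (λ j → δ i k * upper i j)) + sum (λ i → sum (λ j → δ j k * lower i j))
        ≡⟨ cong₂ _+_ (trans (∑-comm (λ i j → δ i k * upper i j))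
            (sum-cong-≗ λ j → sum-δ (λ i → upper i j) k)) (sum-cong-≗ λ i → sum-δ (lower i) k) ⟩
      sum (upper k) + sum (λ i → lower i k) ∎

SameScore : ∀ {Φ n} → Tournament Φ n → Tournament Φ n → Set
SameScore T₁ T₂ = ∀ k → twiceScore T₁ k ≡ twiceScore T₂ k

rowDiff : ∀ {Φ n} → Tournament Φ n → Tournament Φ n → Signed n → Fin n → ℤ
rowDiff T₁ T₂ x k = row T₁ x k - row T₂ x k

sum-neg : ∀ {n} (f : Fin n → ℤ) → sum (λ i → - f i) ≡ - sum f
sum-neg {zero}  f = refl
sum-neg {suc n} f = trans (cong (_+_ (- f zero)) (sum-neg (f ∘ suc)))
    (sym (ℤₚ.neg-distrib-+ (f zero) (sum (f ∘ suc))))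

-- Supplies the zero total for `sum-compensate`; the rows of negative signed vertices reduce to
-- positive ones by `row-~`.
rowDiff-sum : ∀ {Φ n} {T₁ T₂ : Tournament Φ n} → SameScore T₁ T₂ → ∀ x → sum (rowDiff T₁ T₂ x) ≡ 0ℤ
rowDiff-sum {T₁ = T₁} {T₂} eq x = begin
  sum (rowDiff T₁ T₂ x)                       ≡⟨ ∑-distrib-+ (row T₁ x) (λ k → - row T₂ x k) ⟩
  sum (row T₁ x) + sum (λ k → - row T₂ x k)   ≡⟨ cong₂ _+_ (rows x) (sum-neg (row T₂ x)) ⟩
  sum (row T₂ x) - sum (row T₂ x)             ≡⟨ ℤₚ.+-inverseʳ (sum (row T₂ x)) ⟩
  0ℤ                                          ∎
  where
  open ≡-Reasoning
  rows⁺ : ∀ i → sum (row T₁ (i , true)) ≡ sum (row T₂ (i , true))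
  rows⁺ i = trans (row-sum T₁ i) (trans (eq i) (sym (row-sum T₂ i)))
  negated : ∀ T i → sum (row T (i , false)) ≡ - sum (row T (i , true))
  negated T i = trans (sum-cong-≗ (row-~ T (i , true))) (sum-neg (row T (i , true)))
  rows : ∀ x → sum (row T₁ x) ≡ sum (row T₂ x)
  rows (i , true)  = rows⁺ i
  rows (i , false) = trans (negated T₁ i) (trans (cong -_ (rows⁺ i)) (sym (negated T₂ i)))

-- Generators realised as moves

module _ {Φ : CoxType} {n : ℕ} where
  open DecMembership (_≟ᴱ_ {Φ} {n}) using (_∈?_)

  flip : List (Edge Φ n) → Tournament Φ n → Tournament Φ n
  flip G T e with e ∈? G
  ... | yes _ = not (T e)
  ... | no  _ = T e

  flip-∈ : ∀ {G T e} → e ∈ G → flip G T e ≡ not (T e)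
  flip-∈ {G} {T} {e} e∈G with e ∈? G
  ... | yes _ = refl
  ... | no e∉G = contradiction e∈G e∉G

  flip-∉ : ∀ {G T e} → e ∉ G → flip G T e ≡ T e
  flip-∉ {G} {T} {e} e∉G with e ∈? G
  ... | yes e∈G = contradiction e∈G e∉G
  ... | no _ = refl

  -- `GenShape` fixes an order of the games; closing under permutation lets a triangle be named from
  -- any corner.
  IsGenerator : List (Edge Φ n) → Set
  IsGenerator G = ∃[ G′ ] G ↭ G′ × GenShape G′

  twiceSum-↭ : ∀ (T : Tournament Φ n) {G G′} k → G ↭ G′ → twiceSum T G k ≡ twiceSum T G′ k
  twiceSum-↭ T k refl = refl
  twiceSum-↭ T k (prep e p) = cong (_+_ (sgn (T e) * vec e k)) (twiceSum-↭ T k p)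
  twiceSum-↭ T k (↭swap {_} {G′} e f p) =
      trans (cong (λ s → sgn (T e) * vec e k + (sgn (T f) * vec f k + s)) (twiceSum-↭ T k p))
    (exchange (sgn (T e) * vec e k) (sgn (T f) * vec f k) (twiceSum T G′ k))
    where
    exchange : ∀ a b c → a + (b + c) ≡ b + (a + c)
    exchange = solve-∀
  twiceSum-↭ T k (↭trans p q) = trans (twiceSum-↭ T k p) (twiceSum-↭ T k q)

  flip-step : ∀ {G} T → IsGenerator G → Neutral T G → Step T (flip G T)
  flip-step {G} T (G′ , perm , shape) neutral = G′ , shape ,
    (λ k → trans (sym (twiceSum-↭ T k perm)) (neutral k)) ,
    λ e → (λ e∈G′ → flip-∈ (∈-resp-↭ (↭-sym perm) e∈G′)) , (λ e∉G′ → flip-∉ (e∉G′ ∘ ∈-resp-↭ perm))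

  triangle : (x y z : Signed n) → .(base x ≢ base y) → .(base y ≢ base z) → .(base z ≢ base x) →
      List (Edge Φ n)
  triangle x y z xy yz zx = arcEdge x y xy ∷ arcEdge y z yz ∷ arcEdge z x zx ∷ []

  sorted-triangle : ∀ x y z (xy : base x ≢ base y) (yz : base y ≢ base z) (zx : base z ≢ base x) →
                    base z < base y → base y < base x → IsGenerator (triangle x y z xy yz zx)
  sorted-triangle (a , σ) (b , τ) (c , ρ) xy yz zx c<b b<a
    rewrite arcEdge-> {Φ} σ τ b<a xy | arcEdge-> {Φ} τ ρ c<b yz | arcEdge-< {Φ} ρ σ (F.<-trans c<b b<a)
        zx =
    _ , prep _ (↭swap _ _ refl) , shape σ τ ρ
    where
    c<a = F.<-trans c<b b<a
    shape : ∀ σ τ ρ → GenShape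
        (pairEdge {Φ} (same σ τ) a b b<a ∷ pairEdge (same ρ σ) a c c<a ∷ pairEdge (same τ ρ) b c c<b ∷
        [])
    shape true  true  true  = triNeg a b c b<a c<a c<b
    shape false false false = triNeg a b c b<a c<a c<b
    shape true  true  false = triMix₁ a b c b<a c<a c<b
    shape false false true  = triMix₁ a b c b<a c<a c<b
    shape true  false true  = triMix₂ a b c b<a c<a c<b
    shape false true  false = triMix₂ a b c b<a c<a c<b
    shape true  false false = triMix₃ a b c b<a c<a c<b
    shape false true  true  = triMix₃ a b c b<a c<a c<b

  rotate : ∀ {e f g : Edge Φ n} → IsGenerator (e ∷ f ∷ g ∷ []) → IsGenerator (f ∷ g ∷ e ∷ [])
  rotate (G , perm , shape) =
      G , ↭trans (↭trans (prep _ (↭swap _ _ refl)) (↭swap _ _ refl)) perm , shape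

  reflect : ∀ {x y z} (xy : base x ≢ base y) (yz : base y ≢ base z) (zx : base z ≢ base x) →
            IsGenerator (triangle x z y (≢-sym zx) (≢-sym yz) (≢-sym xy)) →
                IsGenerator (triangle x y z xy yz zx)
  reflect {x} {y} {z} xy yz zx (G , perm , shape)
    rewrite arcEdge-sym {Φ} z x zx (≢-sym zx) | arcEdge-sym {Φ} y z yz (≢-sym yz) | arcEdge-sym {Φ} x y
        xy (≢-sym xy) =
    G , ↭trans (↭trans (↭trans (prep _ (↭swap _ _ refl)) (↭swap _ _ refl)) (prep _ (↭swap _ _ refl)))
        perm , shape

  triangle-isGenerator : ∀ x y z (xy : base x ≢ base y) (yz : base y ≢ base z) (zx : base z ≢ base x) →
      IsGenerator (triangle x y z xy yz zx)
  triangle-isGenerator x y z xy yz zx =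
      go (F.<-cmp (base x) (base y)) (F.<-cmp (base y) (base z)) (F.<-cmp (base z) (base x))
    where
    Cmp : Signed n → Signed n → Set
    Cmp u w = Tri (base u < base w) (base u ≡ base w) (base w < base u)
    go : Cmp x y → Cmp y z → Cmp z x → IsGenerator (triangle x y z xy yz zx)
    go (tri≈ _ x≡y _) _ _ = contradiction x≡y xy
    go _ (tri≈ _ y≡z _) _ = contradiction y≡z yz
    go _ _ (tri≈ _ z≡x _) = contradiction z≡x zx
    go (tri< x<y _ _) (tri< y<z _ _) _ =
      reflect xy yz zx (rotate
          (rotate (sorted-triangle z y x (≢-sym yz) (≢-sym xy) (≢-sym zx) x<y y<z)))
    go (tri< x<y _ _) (tri> _ _ z<y) (tri< z<x _ _) =
      reflect xy yz zx (rotate (sorted-triangle y x z (≢-sym xy) (≢-sym zx) (≢-sym yz) z<x x<y))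
    go (tri< x<y _ _) (tri> _ _ z<y) (tri> _ _ x<z) =
        rotate (rotate (sorted-triangle y z x yz zx xy x<z z<y))
    go (tri> _ _ y<x) (tri> _ _ z<y) _ = sorted-triangle x y z xy yz zx z<y y<x
    go (tri> _ _ y<x) (tri< y<z _ _) (tri< z<x _ _) =
      reflect xy yz zx (sorted-triangle x z y (≢-sym zx) (≢-sym yz) (≢-sym xy) y<z z<x)
    go (tri> _ _ y<x) (tri< y<z _ _) (tri> _ _ x<z) = rotate (sorted-triangle z x y zx xy yz y<x x<z)

  triangle-step : ∀ {T} x y z (xy : base x ≢ base y) (yz : base y ≢ base z) (zx : base z ≢ base x) →
                  beats T x y xy ≡ true → beats T y z yz ≡ true → beats T z x zx ≡ true →
                  Step T (flip (triangle x y z xy yz zx) T)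
  triangle-step {T} x y z xy yz zx bxy byz bzx =
      flip-step T (triangle-isGenerator x y z xy yz zx) neutral
    where
    neutral : Neutral T (triangle x y z xy yz zx)
    neutral k rewrite beats-vec {T = T} x y xy bxy k | beats-vec {T = T} y z yz byz k | beats-vec
        {T = T} z x zx bzx k =
      lemma (unit x k) (unit y k) (unit z k)
      where
      lemma : ∀ a b c → a - b + (b - c + (c - a + 0ℤ)) ≡ 0ℤ
      lemma = solve-∀

same-false : ∀ {a b} → same a b ≡ false → a ≡ not b
same-false {true}  {false} _ = refl
same-false {false} {true}  _ = refl

unit-~ : ∀ {n} (x : Signed n) k → unit (~ x) k ≡ - unit x k
unit-~ (i , σ) k = trans (cong (_* δ i k) (sgn-not σ)) (sym (ℤₚ.neg-distribˡ-* (sgn σ) (δ i k)))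

module _ {n : ℕ} where

  halfTriangle : (x y : Signed n) → .(base x ≢ base y) → List (Edge B n)
  halfTriangle x y xy = arcEdge x y xy ∷ half (base x) tt ∷ half (base y) tt ∷ []

  halfTriangle-isGenerator : ∀ x y (xy : base x ≢ base y) → IsGenerator (halfTriangle x y xy)
  halfTriangle-isGenerator (i , σ) (j , τ) i≢j with F.<-cmp i j
  ... | tri≈ _ i≡j _ = contradiction i≡j i≢j
  ... | tri< i<j _ _ = _ , prep _ (↭swap _ _ refl) , shape (same σ τ)
    where
    shape : ∀ b → GenShape (pairEdge b j i i<j ∷ half j tt ∷ half i tt ∷ [])
    shape true  = halfNeg j i i<j tt
    shape false = halfPos j i i<j tt
  ... | tri> _ _ j<i = _ , refl , shape (same σ τ)
    where
    shape : ∀ b → GenShape (pairEdge b i j j<i ∷ half i tt ∷ half j tt ∷ [])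
    shape true  = halfNeg i j j<i tt
    shape false = halfPos i j j<i tt

  -- Half edges act as games against the origin: x beats y, y beats 0, 0 beats x is a cyclic
  -- triangle, with sum (x - y) + y - x = 0.
  halfTriangle-step : ∀ {T : Tournament B n} x y (xy : base x ≢ base y) → beats T x y xy ≡ true →
    same (extraBit T (base x)) (proj₂ x) ≡ false → same (extraBit T (base y)) (proj₂ y) ≡ true →
    Step T (flip (halfTriangle x y xy) T)
  halfTriangle-step {T} x@(i , σ) y@(j , τ) xy bxy hx hy =
      flip-step T (halfTriangle-isGenerator x y xy) neutral
    where
    neutral : Neutral T (halfTriangle x y xy)
    neutral k rewrite beats-vec {T = T} x y xy bxy k
      | same-false {T (half i tt)} {σ} hx | same-true {T (half j tt)} {τ} hy | sgn-not σ =
      lemma (sgn σ) (δ i k) (unit y k)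
      where
      lemma : ∀ s a b → s * a - b + (- s * a + (b + 0ℤ)) ≡ 0ℤ
      lemma = solve-∀

  clover : (x y : Signed n) → .(base x ≢ base y) → List (Edge C n)
  clover x y xy = arcEdge x y xy ∷ arcEdge x (~ y) xy ∷ loop (base x) tt ∷ []

  clover-isGenerator : ∀ x y (xy : base x ≢ base y) → IsGenerator (clover x y xy)
  clover-isGenerator (i , σ) (j , τ) i≢j with F.<-cmp i j
  ... | tri≈ _ i≡j _ = contradiction i≡j i≢j
  ... | tri< i<j _ _ rewrite same-notʳ σ τ = gen (same σ τ)
    where
    gen : ∀ b → IsGenerator (pairEdge b j i i<j ∷ pairEdge (not b) j i i<j ∷ loop i tt ∷ [])
    gen true  = _ , refl , clover₂ j i i<j tt
    gen false = _ , ↭swap _ _ refl , clover₂ j i i<j tt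
  ... | tri> _ _ j<i rewrite same-notʳ σ τ = gen (same σ τ)
    where
    gen : ∀ b → IsGenerator (pairEdge b i j j<i ∷ pairEdge (not b) i j j<i ∷ loop i tt ∷ [])
    gen true  = _ , refl , clover₁ i j j<i tt
    gen false = _ , ↭swap _ _ refl , clover₁ i j j<i tt

  -- The two pair games sum to (x - y) + (x + y) = 2x, which the loop, contributing -2x, cancels.
  clover-step : ∀ {T : Tournament C n} x y (xy : base x ≢ base y) → beats T x y xy ≡ true →
      beats T x (~ y) xy ≡ true →
    same (extraBit T (base x)) (proj₂ x) ≡ false → Step T (flip (clover x y xy) T)
  clover-step {T} x@(i , σ) y xy b₁ b₂ lx = flip-step T (clover-isGenerator x y xy) neutral
    where
    neutral : Neutral T (clover x y xy)
    neutral k rewrite beats-vec {T = T} x y xy b₁ k | beats-vec {T = T} x (~ y) xy b₂ k | unit-~ y k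
      | same-false {T (loop i tt)} {σ} lx | sgn-not σ =
      lemma (sgn σ) (δ i k) (unit y k)
      where
      lemma : ∀ s a b → s * a - b + (s * a - - b + (- s * (+ 2 * a) + 0ℤ)) ≡ 0ℤ
      lemma = solve-∀

-- Moves on a pair of tournaments

≢⇒not≡ : ∀ {a b : Bool} → a ≢ b → not a ≡ b
≢⇒not≡ {true}  {true}  a≢b = contradiction refl a≢b
≢⇒not≡ {true}  {false} a≢b = refl
≢⇒not≡ {false} {true}  a≢b = refl
≢⇒not≡ {false} {false} a≢b = contradiction refl a≢b

-- One sign suffices: every game between `v` and another vertex is an arc from `hub v`, the sign of
-- the opponent telling negative edges from positive ones.
hub : ∀ {n} → Fin n → Signed n
hub v = v , true

module _ {Φ : CoxType} {n : ℕ} where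

  step-sym : {T U : Tournament Φ n} → Step T U → Step U T
  step-sym {T} {U} (G , shape , neutral , flips) = G , shape ,
    (λ k → trans (twiceSum-flipped {T = T} {U} G k (λ e → proj₁ (flips e))) (cong -_ (neutral k))) ,
    λ e → (λ e∈G → trans (sym (𝔹.not-involutive (T e))) (cong not (sym (proj₁ (flips e) e∈G)))) ,
          (λ e∉G → sym (proj₂ (flips e) e∉G))

  -- Paths end in pointwise equality of functions, across which a further step must be carried.
  step-respˡ : {T T′ U : Tournament Φ n} → (∀ e → T e ≡ T′ e) → Step T U → Step T′ U
  step-respˡ {T} {T′} T≗T′ (G , shape , neutral , flips) = G , shape ,
    (λ k → trans (cong sumℤ (map-cong (λ e → cong (λ b → sgn b * vec e k) (sym (T≗T′ e))) G))
        (neutral k)) ,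
    λ e → (λ e∈G → trans (proj₁ (flips e) e∈G) (cong not (T≗T′ e))) ,
          (λ e∉G → trans (proj₂ (flips e) e∉G) (T≗T′ e))

  path-snoc : ∀ {T U V : Tournament Φ n} {m} → Path T U m → Step U V → Path T V (suc m)
  path-snoc (done T≗U)  s = step (step-respˡ (λ e → sym (T≗U e)) s) (done λ _ → refl)
  path-snoc (step s₀ p) s = step s₀ (path-snoc p s)

  -- Moves may be played on either of the two tournaments; those on the second are
  -- traversed backwards once the two have become equal.
  data Moves : (T₁ T₂ U₁ U₂ : Tournament Φ n) → ℕ → Set where
    none  : ∀ {T₁ T₂} → Moves T₁ T₂ T₁ T₂ 0
    left  : ∀ {T₁ T₂ T U₁ U₂ m} → Step T₁ T → Moves T T₂ U₁ U₂ m → Moves T₁ T₂ U₁ U₂ (suc m)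
    right : ∀ {T₁ T₂ T U₁ U₂ m} → Step T₂ T → Moves T₁ T U₁ U₂ m → Moves T₁ T₂ U₁ U₂ (suc m)

  moves-path : ∀ {T₁ T₂ U₁ U₂ m} → Moves T₁ T₂ U₁ U₂ m → (∀ e → U₁ e ≡ U₂ e) → Path T₁ T₂ m
  moves-path none        eq = done eq
  moves-path (left s p)  eq = step s (moves-path p eq)
  moves-path (right s p) eq = path-snoc (moves-path p eq) (step-sym s)

  moves-++ : ∀ {T₁ T₂ U₁ U₂ V₁ V₂ m m′} → Moves T₁ T₂ U₁ U₂ m → Moves U₁ U₂ V₁ V₂ m′ →
      Moves T₁ T₂ V₁ V₂ (m ℕ+ m′)
  moves-++ none        q = q
  moves-++ (left s p)  q = left s (moves-++ p q)
  moves-++ (right s p) q = right s (moves-++ p q)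

  moves-swap : ∀ {T₁ T₂ U₁ U₂ m} → Moves T₁ T₂ U₁ U₂ m → Moves T₂ T₁ U₂ U₁ m
  moves-swap none        = none
  moves-swap (left s p)  = right s (moves-swap p)
  moves-swap (right s p) = left s (moves-swap p)

  sameScore-sym : {T₁ T₂ : Tournament Φ n} → SameScore T₁ T₂ → SameScore T₂ T₁
  sameScore-sym eq k = sym (eq k)

  sameScore-left : {T₁ T₂ T : Tournament Φ n} → Step T₁ T → SameScore T₁ T₂ → SameScore T T₂
  sameScore-left s eq k = trans (step-score s k) (eq k)

  sameScore-right : {T₁ T₂ T : Tournament Φ n} → Step T₂ T → SameScore T₁ T₂ → SameScore T₁ T
  sameScore-right s eq k = trans (eq k) (sym (step-score s k))

  moves-score : ∀ {T₁ T₂ U₁ U₂ m} → Moves T₁ T₂ U₁ U₂ m → SameScore T₁ T₂ → SameScore U₁ U₂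
  moves-score none        eq = eq
  moves-score {T₂ = T₂} (left s p)  eq = moves-score p (sameScore-left {T₂ = T₂} s eq)
  moves-score {T₁ = T₁} (right s p) eq = moves-score p (sameScore-right {T₁ = T₁} s eq)

  AgreeOn : (Edge Φ n → Set) → Tournament Φ n → Tournament Φ n → Set
  AgreeOn P T₁ T₂ = ∀ e → P e → T₁ e ≡ T₂ e

  record Fix (T₁ T₂ : Tournament Φ n) (bound : ℕ) (P : Edge Φ n → Set) : Set where
    constructor fix
    field
      {U₁ U₂} : Tournament Φ n
      {count} : ℕ
      count≤  : count ℕ.≤ bound
      moves   : Moves T₁ T₂ U₁ U₂ count
      agree   : AgreeOn P U₁ U₂

  fix-none : ∀ {T₁ T₂ m P} → AgreeOn P T₁ T₂ → Fix T₁ T₂ m P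
  fix-none agree = fix z≤n none agree

  fix-map : ∀ {T₁ T₂ m P Q} → (∀ e → Q e → P e) → Fix T₁ T₂ m P → Fix T₁ T₂ m Q
  fix-map Q⊆P (fix c p agree) = fix c p λ e → agree e ∘ Q⊆P e

  fix-weaken : ∀ {T₁ T₂ m m′ P} → m ℕ.≤ m′ → Fix T₁ T₂ m P → Fix T₁ T₂ m′ P
  fix-weaken m≤m′ (fix c p agree) = fix (ℕₚ.≤-trans c m≤m′) p agree

  fix-swap : ∀ {T₁ T₂ m P} → Fix T₁ T₂ m P → Fix T₂ T₁ m P
  fix-swap (fix c p agree) = fix c (moves-swap p) λ e Pe → sym (agree e Pe)

  fix-left : ∀ {T₁ T₂ T m P} → Step T₁ T → Fix T T₂ m P → Fix T₁ T₂ (suc m) P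
  fix-left s (fix c p agree) = fix (s≤s c) (left s p) agree

  -- The second stage has to cope with whatever pair the first leaves behind, knowing only equal
  -- scores and agreement on `P`.
  fix-bind : ∀ {T₁ T₂ m m′ P Q} → SameScore T₁ T₂ → Fix T₁ T₂ m P →
             (∀ {U₁ U₂} → SameScore U₁ U₂ → AgreeOn P U₁ U₂ → Fix U₁ U₂ m′ Q) → Fix T₁ T₂ (m ℕ+ m′) Q
  fix-bind eq (fix c p agree) next with next (moves-score p eq) agree
  ... | fix c′ p′ agree′ = fix (ℕₚ.+-mono-≤ c c′) (moves-++ p p′) agree′

  -- A game is due at its smallest vertex: `Below v` holds the games settled before `v` is treated,
  -- `Upto v` those settled afterwards.
  Below Upto ExtraAt : Fin n → Edge Φ n → Set
  Below v e = ∃[ u ] u < v × Touches e u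
  Upto  v e = ∃[ u ] u ≤ v × Touches e u
  ExtraAt v (neg _ _ _) = ⊥
  ExtraAt v (pos _ _ _) = ⊥
  ExtraAt v (half i _)  = i ≡ v
  ExtraAt v (loop i _)  = i ≡ v

  below⇒upto : ∀ {v} e → Below v e → Upto v e
  below⇒upto e (u , u<v , t) = u , ℕₚ.<⇒≤ u<v , t

  spoke : ∀ {v} (x : Signed n) → v < base x → Edge Φ n
  spoke {v} x v<x = arcEdge (hub v) x (F.<⇒≢ v<x)

  -- What a correction must preserve. Being relative to the current pair, it also protects the
  -- spokes of `v` corrected earlier, while games still in disagreement may change.
  Kept : Fin n → (T₁ T₂ : Tournament Φ n) → Edge Φ n → Set
  Kept v T₁ T₂ e = Upto v e × T₁ e ≡ T₂ e

  Split : ∀ {v} (T₁ T₂ : Tournament Φ n) (x : Signed n) → v < base x → Set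
  Split {v} T₁ T₂ x v<x = beats T₁ (hub v) x (F.<⇒≢ v<x) ≡ true × beats T₂ (hub v) x (F.<⇒≢ v<x) ≡ false

  spoke-upto : ∀ {v} x (v<x : v < base x) → Upto v (spoke x v<x)
  spoke-upto {v} x v<x = v , ℕₚ.≤-refl , arcEdge-touches (hub v) x (F.<⇒≢ v<x) (inj₁ refl)

  arc-free : ∀ {v} x y (xy : base x ≢ base y) → v < base x → v < base y → ¬ Upto v (arcEdge x y xy)
  arc-free x y xy v<x v<y (u , u≤v , t) with arcEdge-touched x y xy t
  ... | inj₁ refl = ℕₚ.<⇒≱ v<x u≤v
  ... | inj₂ refl = ℕₚ.<⇒≱ v<y u≤v

  split-differs : ∀ {v T₁ T₂} x (v<x : v < base x) → Split T₁ T₂ x v<x →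
      T₁ (spoke x v<x) ≢ T₂ (spoke x v<x)
  split-differs x v<x (b₁ , b₂) eq with trans (sym b₁) (trans (beats-cong (hub _) x (F.<⇒≢ v<x) eq) b₂)
  ... | ()

  beats-rev : ∀ (T : Tournament Φ n) x y (p : base x ≢ base y) (q : base y ≢ base x) {b} →
      beats T x y p ≡ b → beats T y x q ≡ not b
  beats-rev T x y p q eq = trans (beats-sym T x y p q) (cong not eq)

  -- Correcting two spokes that differ in opposite directions

  PairGoal : ∀ {v} (T₁ T₂ : Tournament Φ n) x y → v < base x → v < base y → Edge Φ n → Set
  PairGoal {v} T₁ T₂ x y v<x v<y e = e ≡ spoke x v<x ⊎ e ≡ spoke y v<y ⊎ Kept v T₁ T₂ e

  pairGoal-upto : ∀ {v T₁ T₂} x y (v<x : v < base x) (v<y : v < base y) {e} →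
      PairGoal T₁ T₂ x y v<x v<y e → Upto v e
  pairGoal-upto x y v<x v<y (inj₁ refl)        = spoke-upto x v<x
  pairGoal-upto x y v<x v<y (inj₂ (inj₁ refl)) = spoke-upto y v<y
  pairGoal-upto x y v<x v<y (inj₂ (inj₂ kept)) = proj₁ kept

  -- The cyclic triangle meets the games up to `v` only in the two spokes, and there the tournaments
  -- differ, so one flip corrects both.
  direct : ∀ {v T₁ T₂} x y (v<x : v < base x) (v<y : v < base y) (xy : base x ≢ base y) →
           Split T₁ T₂ x v<x → Split T₂ T₁ y v<y → beats T₁ x y xy ≡ true →
           Fix T₁ T₂ 1 (PairGoal T₁ T₂ x y v<x v<y)
  direct {v} {T₁} {T₂} x y v<x v<y xy sx sy bxy =
    fix-left (triangle-step (hub v) x y vx xy yv (proj₁ sx) bxy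
        (beats-rev T₁ (hub v) y vy yv (proj₂ sy))) (fix-none agree)
    where
    open DecMembership (_≟ᴱ_ {Φ} {n}) using (_∈?_)
    vx = F.<⇒≢ v<x
    vy = F.<⇒≢ v<y
    yv = ≢-sym vy
    G = triangle (hub v) x y vx xy yv
    spoke-y : spoke y v<y ≡ arcEdge y (hub v) yv
    spoke-y = sym (arcEdge-sym (hub v) y vy yv)
    differs : ∀ e → Upto v e → e ∈ G → T₁ e ≢ T₂ e
    differs e up (here refl) = split-differs x v<x sx
    differs e up (there (here refl)) = contradiction up (arc-free x y xy v<x v<y)
    differs e up (there (there (here refl))) eq =
      split-differs y v<y sy (subst (λ f → T₂ f ≡ T₁ f) (sym spoke-y) (sym eq))
    agree : AgreeOn (PairGoal T₁ T₂ x y v<x v<y) (flip G T₁) T₂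
    agree e goal with e ∈? G
    ... | yes e∈G = ≢⇒not≡ (differs e (pairGoal-upto {T₁ = T₁} {T₂} x y v<x v<y goal) e∈G)
    ... | no e∉G with goal
    ...   | inj₁ refl = contradiction (here refl) e∉G
    ...   | inj₂ (inj₁ refl) = contradiction (there (there (here spoke-y))) e∉G
    ...   | inj₂ (inj₂ kept) = proj₂ kept

  -- Preparation for `direct`, which needs x to beat y; only games among vertices above `v` may
  -- change.
  Improve : Fin n → Tournament Φ n → (x y : Signed n) → .(base x ≢ base y) → Set
  Improve v T x y xy = ∃[ U ] Step T U × (∀ e → Upto v e → U e ≡ T e) × beats U x y xy ≡ true

  improve : ∀ {v T G x y} .(xy : base x ≢ base y) → Step T (flip G T) → (∀ e → e ∈ G → ¬ Upto v e) →
            arcEdge x y xy ∈ G → beats T x y xy ≡ false → Improve v T x y xy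
  improve {v} {T} {G} {x} {y} xy s free xy∈G bxy =
      flip G T , s , (λ e up → flip-∉ λ e∈G → free e e∈G up) ,
    trans (beats-not {T = T} {U = flip G T} {x} {y} xy (flip-∈ xy∈G)) (cong not bxy)

  improve-triangle : ∀ {v T} x y z (xy : base x ≢ base y) (xz : base x ≢ base z) (yz : base y ≢ base z) →
    v < base x → v < base y → v < base z → beats T x y xy ≡ false → beats T x z xz ≡ true →
    beats T y z yz ≡ false → Improve v T x y xy
  improve-triangle {v} {T} x y z xy xz yz v<x v<y v<z bxy bxz byz =
    improve xy (triangle-step x z y xz (≢-sym yz) (≢-sym xy) bxz (beats-rev T y z yz (≢-sym yz) byz)
        (beats-rev T x y xy (≢-sym xy) bxy))
      free (there (there (here (sym (arcEdge-sym x y xy (≢-sym xy)))))) bxy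
    where
    free : ∀ e → e ∈ triangle x z y xz (≢-sym yz) (≢-sym xy) → ¬ Upto v e
    free e (here refl) = arc-free x z xz v<x v<z
    free e (there (here refl)) = arc-free z y (≢-sym yz) v<z v<y
    free e (there (there (here refl))) = arc-free y x (≢-sym xy) v<y v<x

half-free : ∀ {n} {v i : Fin n} → v < i → ¬ Upto v (half {B} i tt)
half-free v<i (_ , u≤v , refl) = ℕₚ.<⇒≱ v<i u≤v

loop-free : ∀ {n} {v i : Fin n} → v < i → ¬ Upto v (loop {C} i tt)
loop-free v<i (_ , u≤v , refl) = ℕₚ.<⇒≱ v<i u≤v

positive : ∀ {Φ n} → Tournament Φ n → Signed n → Bool
positive T (i , σ) = same (extraBit T i) σ

positive-~ : ∀ {Φ n} (T : Tournament Φ n) x → positive T (~ x) ≡ not (positive T x)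
positive-~ T (i , σ) = same-notʳ (extraBit T i) σ

beats-~ˡ : ∀ {Φ n} (T : Tournament Φ n) x y (p : base x ≢ base y) →
    beats T (~ x) y p ≡ not (beats T x (~ y) p)
beats-~ˡ T x y p = trans (beats-sym T y (~ x) (≢-sym p) p) (cong not (beats-skew T x y p (≢-sym p)))

-- In type B, y beats x, x beats the origin and the origin beats y. In type C, if y also beats
-- `~ x`, the negative loop of y completes a clover at y; otherwise `~ x` beats both y and `~ y`,
-- and the loop of x, negative for `~ x`, completes one there.
improve-extra : ∀ {Φ n v} {T : Tournament Φ n} x y (xy : base x ≢ base y) → v < base x → v < base y →
  0ℤ <ᶻ weight Φ → beats T x y xy ≡ false → positive T x ≡ true → positive T y ≡ false →
      Improve v T x y xy
improve-extra {B} {T = T} x y xy v<x v<y w bxy px py =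
  improve xy (halfTriangle-step y x yx (beats-rev T x y xy yx bxy) py px) free
      (here (sym (arcEdge-sym x y xy yx))) bxy
  where
  yx = ≢-sym xy
  free : ∀ e → e ∈ halfTriangle y x yx → ¬ Upto _ e
  free e (here refl) = arc-free y x yx v<y v<x
  free e (there (here refl)) = half-free v<y
  free e (there (there (here refl))) = half-free v<x
improve-extra {C} {v = v} {T} x y xy v<x v<y w bxy px py with beats T y (~ x) (≢-sym xy) in eq
... | true = improve xy (clover-step y x yx (beats-rev T x y xy yx bxy) eq py) free
    (here (sym (arcEdge-sym x y xy yx))) bxy
  where
  yx = ≢-sym xy
  free : ∀ e → e ∈ clover y x yx → ¬ Upto v e
  free e (here refl) = arc-free y x yx v<y v<x
  free e (there (here refl)) = arc-free y (~ x) yx v<y v<x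
  free e (there (there (here refl))) = loop-free v<y
... | false = improve xy (clover-step (~ x) y xy b₁ b₂ (trans (positive-~ T x) (cong not px))) free
    (there (here x–y)) bxy
  where
  yx = ≢-sym xy
  b₁ : beats T (~ x) y xy ≡ true
  b₁ = beats-rev T y (~ x) yx xy eq
  b₂ : beats T (~ x) (~ y) xy ≡ true
  b₂ = trans (beats-~ˡ T x (~ y) xy)
      (trans (cong (λ z → not (beats T x (proj₁ y , z) xy)) (𝔹.not-involutive (proj₂ y)))
      (cong not bxy))
  x–y : arcEdge x y xy ≡ arcEdge (~ x) (~ y) xy
  x–y = trans (cong (λ σ → arcEdge x (proj₁ y , σ) xy) (sym (𝔹.not-involutive (proj₂ y))))
    (trans (sym (arcEdge-skew x (~ y) xy yx)) (arcEdge-sym (~ x) (~ y) xy yx))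
  free : ∀ e → e ∈ clover (~ x) y xy → ¬ Upto v e
  free e (here refl) = arc-free (~ x) y xy v<x v<y
  free e (there (here refl)) = arc-free (~ x) (~ y) xy v<x v<y
  free e (there (there (here refl))) = loop-free v<x
improve-extra {D} x y xy v<x v<y (+<+ ())

-- Counting: the preparatory move exists

∀𝔹? : {P : Bool → Set} → (∀ b → Dec (P b)) → Dec (∀ b → P b)
∀𝔹? P? = map′ (λ { (t , f) true → t ; (t , f) false → f }) (λ h → h true , h false)
    (P? true ×-dec P? false)

decide : {A : Set} (A? : Dec A) {_ : True A?} → A
decide A? {t} = toWitness t

-- The two split spokes contribute 4; the games against `~ hub v`, with arbitrary outcomes p and q,
-- contribute at least -4.
hub-bound : ∀ p₁ p₂ q₁ q₂ →
  0ℤ ≤ᶻ (sgn true + sgn p₁ - (sgn false + sgn p₂)) - (sgn false + sgn q₁ - (sgn true + sgn q₂))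
hub-bound = decide (∀𝔹? λ p₁ → ∀𝔹? λ p₂ → ∀𝔹? λ q₁ → ∀𝔹? λ q₂ → _ ℤₚ.≤? _)

Gain : CoxType → Bool → Bool → Set
Gain Φ a b = 0ℤ <ᶻ weight Φ × a ≡ true × b ≡ false

gain? : ∀ Φ a b → Dec (Gain Φ a b)
gain? Φ a b = (0ℤ ℤₚ.<? weight Φ) ×-dec (a 𝔹.≟ true) ×-dec (b 𝔹.≟ false)

-- The columns of x and y in the row of y minus the row of x. Here a and b are the half edges or
-- loops of x and y, and r is the game between x and `~ y`, which enters both rows equally and
-- cancels.
ends : CoxType → (a₁ a₂ b₁ b₂ r₁ r₂ : Bool) → ℤ
ends Φ a₁ a₂ b₁ b₂ r₁ r₂ =
  ((sgn true + sgn r₁ - (sgn false + sgn r₂)) - (weight Φ * sgn a₁ - weight Φ * sgn a₂))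
  + ((weight Φ * sgn b₁ - weight Φ * sgn b₂) - (sgn false + sgn r₁ - (sgn true + sgn r₂)) + 0ℤ)

-- In signs the value is 4 + w((b₁ - a₁) + (a₂ - b₂)) with w the weight. The 4 comes from the game
-- between x and y, and for positive w the excluded gains are exactly the negative differences.
endpoints-bound : ∀ Φ a₁ a₂ b₁ b₂ r₁ r₂ → ¬ Gain Φ a₁ b₁ → ¬ Gain Φ b₂ a₂ →
    0ℤ <ᶻ ends Φ a₁ a₂ b₁ b₂ r₁ r₂
endpoints-bound = λ { B → decide (bound? B) ; C → decide (bound? C) ; D → decide (bound? D) }
  where
  bound? : ∀ Φ → Dec (∀ a₁ a₂ b₁ b₂ r₁ r₂ → ¬ Gain Φ a₁ b₁ → ¬ Gain Φ b₂ a₂ →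
      0ℤ <ᶻ ends Φ a₁ a₂ b₁ b₂ r₁ r₂)
  bound? Φ = ∀𝔹? λ a₁ → ∀𝔹? λ a₂ → ∀𝔹? λ b₁ → ∀𝔹? λ b₂ → ∀𝔹? λ r₁ → ∀𝔹? λ r₂ →
    (¬? (gain? Φ a₁ b₁)) →-dec ((¬? (gain? Φ b₂ a₂)) →-dec (0ℤ ℤₚ.<? ends Φ a₁ a₂ b₁ b₂ r₁ r₂))

-- Regrouped, the quantity is (y₁ - x₁) + (x₂ - y₂), so one of these differences is negative.
negative-gap : ∀ x₁ x₂ y₁ y₂ → sgn y₁ - sgn y₂ - (sgn x₁ - sgn x₂) <ᶻ 0ℤ →
               (x₁ ≡ true × y₁ ≡ false) ⊎ (y₂ ≡ true × x₂ ≡ false)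
negative-gap = decide (∀𝔹? λ x₁ → ∀𝔹? λ x₂ → ∀𝔹? λ y₁ → ∀𝔹? λ y₂ → (_ ℤₚ.<? 0ℤ) →-dec
  (((x₁ 𝔹.≟ true) ×-dec (y₁ 𝔹.≟ false)) ⊎-dec ((y₂ 𝔹.≟ true) ×-dec (x₂ 𝔹.≟ false))))

negative-+ : ∀ {i j} → i + j <ᶻ 0ℤ → i <ᶻ 0ℤ ⊎ j <ᶻ 0ℤ
negative-+ {i} {j} i+j<0 with i ℤₚ.<? 0ℤ
... | yes i<0 = inj₁ i<0
... | no  i≮0 = inj₂
    (ℤₚ.≤-<-trans (subst (_≤ᶻ i + j) (ℤₚ.+-identityˡ j) (ℤₚ.+-monoˡ-≤ j (ℤₚ.≮⇒≥ i≮0))) i+j<0)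

module _ {Φ : CoxType} {n : ℕ} where

  row-at : ∀ (T : Tournament Φ n) x z (p : base x ≢ base z) →
      row T x (base z) ≡ sgn (beats T x z p) + sgn (beats T x (~ z) p)
  row-at T x (k , true)  p = row-other T x p
  row-at T x (k , false) p = trans (row-other T x p) (ℤₚ.+-comm (sgn (beats T x (k , true) p)) _)

  rowDiff-at : ∀ (T₁ T₂ : Tournament Φ n) x z (p : base x ≢ base z) → rowDiff T₁ T₂ x (base z) ≡
    sgn (beats T₁ x z p) + sgn (beats T₁ x (~ z) p) - (sgn (beats T₂ x z p) + sgn (beats T₂ x (~ z) p))
  rowDiff-at T₁ T₂ x z p = cong₂ _-_ (row-at T₁ x z p) (row-at T₂ x z p)

  rowDiff-self : ∀ (T₁ T₂ : Tournament Φ n) x →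
    rowDiff T₁ T₂ x (base x) ≡ weight Φ * sgn (positive T₁ x) - weight Φ * sgn (positive T₂ x)
  rowDiff-self T₁ T₂ x = cong₂ _-_ (row-self T₁ x) (row-self T₂ x)

  rowDiff-below : ∀ {v} {T₁ T₂ : Tournament Φ n} x {k} → base x ≢ k → AgreeOn (Below v) T₁ T₂ → k < v →
      rowDiff T₁ T₂ x k ≡ 0ℤ
  rowDiff-below {v} {T₁} {T₂} x {k} x≢k agree k<v =
      trans (cong (_- row T₂ x k) rows) (ℤₚ.+-inverseʳ (row T₂ x k))
    where
    bit : ∀ τ → beats T₁ x (k , τ) x≢k ≡ beats T₂ x (k , τ) x≢k
    bit τ = beats-cong x (k , τ) x≢k (agree _ (k , k<v , arcEdge-touches x (k , τ) x≢k (inj₂ refl)))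
    rows : row T₁ x k ≡ row T₂ x k
    rows = trans (row-other T₁ x x≢k)
        (trans (cong₂ (λ a b → sgn a + sgn b) (bit true) (bit false)) (sym (row-other T₂ x x≢k)))

  -- Either x beats z and z beats y for some z above `v`, or the half edges or loops play the part
  -- of such a z.
  Witness : Fin n → Tournament Φ n → (x y : Signed n) → Set
  Witness v T x y = (∃[ z ] v < base z × Σ (base x ≢ base z) λ xz → Σ (base y ≢ base z) λ yz →
                       beats T x z xz ≡ true × beats T y z yz ≡ false)
                    ⊎ Gain Φ (positive T x) (positive T y)

  witness-improves : ∀ {v} {T : Tournament Φ n} x y (xy : base x ≢ base y) → v < base x → v < base y →
      beats T x y xy ≡ false →
                     Witness v T x y → Improve v T x y xy
  witness-improves x y xy v<x v<y bxy (inj₁ (z , v<z , xz , yz , bxz , byz)) =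
    improve-triangle x y z xy xz yz v<x v<y v<z bxy bxz byz
  witness-improves x y xy v<x v<y bxy (inj₂ (w , px , py)) = improve-extra x y xy v<x v<y w bxy px py

  -- Were there no witness, the difference of the scores of x and y would be strictly
  -- smaller in T₁ than in T₂.
  counting : ∀ {v} {T₁ T₂ : Tournament Φ n} x y (v<x : v < base x) (v<y : v < base y)
      (xy : base x ≢ base y) →
    SameScore T₁ T₂ → AgreeOn (Below v) T₁ T₂ → Split T₁ T₂ x v<x → Split T₂ T₁ y v<y →
    beats T₁ x y xy ≡ false → beats T₂ x y xy ≡ true → Witness v T₁ x y ⊎ Witness v T₂ y x
  counting {v} {T₁} {T₂} x y v<x v<y xy score agree sx sy b₁ b₂
    with gain? Φ (positive T₁ x) (positive T₁ y) | gain? Φ (positive T₂ y) (positive T₂ x)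
  ... | yes g | _ = inj₁ (inj₂ g)
  ... | no _ | yes g = inj₂ (inj₂ g)
  ... | no ¬g₁ | no ¬g₂ = locate (sum-compensate gap unique total exceptional)
    where
    xv = ≢-sym (F.<⇒≢ v<x)
    yv = ≢-sym (F.<⇒≢ v<y)
    yx = ≢-sym xy
    V = hub v
    gap : Fin n → ℤ
    gap k = rowDiff T₁ T₂ y k - rowDiff T₁ T₂ x k
    unique : Unique (v ∷ base x ∷ base y ∷ [])
    unique = (≢-sym xv ∷ ≢-sym yv ∷ []) ∷ (xy ∷ []) ∷ [] ∷ []
    total : sum gap ≡ 0ℤ
    total = trans (∑-distrib-+ (rowDiff T₁ T₂ y) (λ k → - rowDiff T₁ T₂ x k))
      (cong₂ _+_ (rowDiff-sum {T₁ = T₁} {T₂} score y)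
          (trans (sum-neg (rowDiff T₁ T₂ x)) (cong -_ (rowDiff-sum {T₁ = T₁} {T₂} score x))))
    at-hub : 0ℤ ≤ᶻ gap v
    at-hub rewrite rowDiff-at T₁ T₂ y V yv | rowDiff-at T₁ T₂ x V xv
      | beats-rev T₁ V y (F.<⇒≢ v<y) yv (proj₂ sy) | beats-rev T₂ V y (F.<⇒≢ v<y) yv (proj₁ sy)
      | beats-rev T₁ V x (F.<⇒≢ v<x) xv (proj₁ sx) | beats-rev T₂ V x (F.<⇒≢ v<x) xv (proj₂ sx) =
      hub-bound (beats T₁ y (~ V) yv) (beats T₂ y (~ V) yv) (beats T₁ x (~ V) xv) (beats T₂ x (~ V) xv)
    at-ends : 0ℤ <ᶻ gap (base x) + (gap (base y) + 0ℤ)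
    at-ends rewrite rowDiff-at T₁ T₂ y x yx | rowDiff-self T₁ T₂ x | rowDiff-self T₁ T₂ y | rowDiff-at
        T₁ T₂ x y xy
      | beats-rev T₁ x y xy yx b₁ | beats-rev T₂ x y xy yx b₂ | b₁ | b₂
      | beats-skew T₁ x y xy yx | beats-skew T₂ x y xy yx =
      endpoints-bound Φ (positive T₁ x) (positive T₂ x) (positive T₁ y) (positive T₂ y)
          (beats T₁ x (~ y) xy) (beats T₂ x (~ y) xy) ¬g₁ ¬g₂
    exceptional : 0ℤ <ᶻ gap v + (gap (base x) + (gap (base y) + 0ℤ))
    exceptional = ℤₚ.+-mono-≤-< at-hub at-ends
    locate : (∃[ k ] (k ∉ v ∷ base x ∷ base y ∷ []) × gap k <ᶻ 0ℤ) → Witness v T₁ x y ⊎ Witness v T₂ y x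
    locate (k , k∉ , gap<0) with F.<-cmp v k
    ... | tri≈ _ refl _ = contradiction (here refl) k∉
    ... | tri> _ _ k<v = contradiction gap<0 (ℤₚ.<-irrefl (cong₂ _-_
            (rowDiff-below {T₁ = T₁} {T₂} y (λ { refl → k∉ (there (there (here refl))) }) agree k<v)
            (rowDiff-below {T₁ = T₁} {T₂} x (λ { refl → k∉ (there (here refl)) }) agree k<v)))
    -- Above `v`, a negative entry divides between the two signs of `k`; a sign with a negative
    -- share serves as the z of the witness.
    ... | tri< v<k _ _ =
        [ conclude true , conclude false ]′
        (negative-+ {term true} {term false} (subst (_<ᶻ 0ℤ) terms gap<0))
      where
      xk : base x ≢ k
      xk refl = k∉ (there (here refl))
      yk : base y ≢ k
      yk refl = k∉ (there (there (here refl)))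
      s : Tournament Φ n → (w : Signed n) → base w ≢ k → Bool → ℤ
      s T w p τ = sgn (beats T w (k , τ) p)
      term : Bool → ℤ
      term τ = s T₁ y yk τ - s T₂ y yk τ - (s T₁ x xk τ - s T₂ x xk τ)
      shuffle : ∀ a b c d e f g h →
          (a + b - (c + d)) - (e + f - (g + h)) ≡ (a - c - (e - g)) + (b - d - (f - h))
      shuffle = solve-∀
      terms : gap k ≡ term true + term false
      terms = trans (cong₂ _-_ (rowDiff-at T₁ T₂ y (k , true) yk) (rowDiff-at T₁ T₂ x (k , true) xk))
        (shuffle (s T₁ y yk true) (s T₁ y yk false) (s T₂ y yk true) (s T₂ y yk false)
                 (s T₁ x xk true) (s T₁ x xk false) (s T₂ x xk true) (s T₂ x xk false))
      conclude : ∀ τ → term τ <ᶻ 0ℤ → Witness v T₁ x y ⊎ Witness v T₂ y x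
      conclude τ t<0 with negative-gap (beats T₁ x (k , τ) xk) (beats T₂ x (k , τ) xk)
          (beats T₁ y (k , τ) yk) (beats T₂ y (k , τ) yk) t<0
      ... | inj₁ (bx , by) = inj₁ (inj₁ ((k , τ) , v<k , xk , yk , bx , by))
      ... | inj₂ (by , bx) = inj₂ (inj₁ ((k , τ) , v<k , yk , xk , by , bx))

  split-cong : ∀ {v} {T₁ T₂ U₁ U₂ : Tournament Φ n} x (v<x : v < base x) →
      U₁ (spoke x v<x) ≡ T₁ (spoke x v<x) → U₂ (spoke x v<x) ≡ T₂ (spoke x v<x) →
               Split T₁ T₂ x v<x → Split U₁ U₂ x v<x
  split-cong x v<x eq₁ eq₂ (b₁ , b₂) =
    trans (beats-cong (hub _) x (F.<⇒≢ v<x) eq₁) b₁ , trans (beats-cong (hub _) x (F.<⇒≢ v<x) eq₂) b₂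

  -- The bound 2 is one preparatory move and one triangle. The preparation takes place above `v`, so
  -- both spokes stay split and all agreement up to `v` survives.
  pairFix : ∀ {v} {T₁ T₂ : Tournament Φ n} x y (v<x : v < base x) (v<y : v < base y)
      (xy : base x ≢ base y) →
    SameScore T₁ T₂ → AgreeOn (Below v) T₁ T₂ → Split T₁ T₂ x v<x → Split T₂ T₁ y v<y →
    Fix T₁ T₂ 2 (PairGoal T₁ T₂ x y v<x v<y)
  pairFix {v} {T₁} {T₂} x y v<x v<y xy score agree sx sy with beats T₁ x y xy in b₁ | beats T₂ x y
      xy in b₂
  ... | true | _ = fix-weaken (s≤s z≤n) (direct x y v<x v<y xy sx sy b₁)
  ... | false | false =
      fix-weaken (s≤s z≤n)
      (fix-swap (fix-map goal
      (direct y x v<y v<x (≢-sym xy) sy sx (beats-rev T₂ x y xy (≢-sym xy) b₂))))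
    where
    goal : ∀ e → PairGoal T₁ T₂ x y v<x v<y e → PairGoal T₂ T₁ y x v<y v<x e
    goal e (inj₁ eq) = inj₂ (inj₁ eq)
    goal e (inj₂ (inj₁ eq)) = inj₁ eq
    goal e (inj₂ (inj₂ (up , eq))) = inj₂ (inj₂ (up , sym eq))
  -- Neither triangle is cyclic; `counting` tells in which tournament the game between x and y can
  -- be reversed.
  ... | false | true = [ viaLeft ∘ witness-improves x y xy v<x v<y b₁ ,
                         viaRight ∘ witness-improves y x (≢-sym xy) v<y v<x
                             (beats-rev T₂ x y xy (≢-sym xy) b₂) ]′
                         (counting x y v<x v<y xy score agree sx sy b₁ b₂)
    where
    viaLeft : Improve v T₁ x y xy → Fix T₁ T₂ 2 (PairGoal T₁ T₂ x y v<x v<y)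
    viaLeft (U , s , fixed , bxy) = fix-left s (fix-map goal (direct x y v<x v<y xy
      (split-cong x v<x (fixed _ (spoke-upto x v<x)) refl sx)
          (split-cong y v<y refl (fixed _ (spoke-upto y v<y)) sy) bxy))
      where
      goal : ∀ e → PairGoal T₁ T₂ x y v<x v<y e → PairGoal U T₂ x y v<x v<y e
      goal e = Sum.map₂ (Sum.map₂ λ (up , eq) → up , trans (fixed e up) eq)
    viaRight : Improve v T₂ y x (≢-sym xy) → Fix T₁ T₂ 2 (PairGoal T₁ T₂ x y v<x v<y)
    viaRight (U , s , fixed , byx) = fix-swap (fix-left s (fix-map goal (direct y x v<y v<x (≢-sym xy)
      (split-cong y v<y (fixed _ (spoke-upto y v<y)) refl sy)
          (split-cong x v<x refl (fixed _ (spoke-upto x v<x)) sx) byx)))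
      where
      goal : ∀ e → PairGoal T₁ T₂ x y v<x v<y e → PairGoal U T₁ y x v<y v<x e
      goal e (inj₁ eq) = inj₂ (inj₁ eq)
      goal e (inj₂ (inj₁ eq)) = inj₁ eq
      goal e (inj₂ (inj₂ (up , eq))) = inj₂ (inj₂ (up , trans (fixed e up) (sym eq)))

-- A spoke whose only partner is its opposite

choose : ∀ {n} {P Q : Fin n → Set} → (∀ k → P k ⊎ Q k) → ∃ P ⊎ (∀ k → Q k)
choose {zero}  P⊎Q = inj₂ λ ()
choose {suc n} P⊎Q with P⊎Q zero | choose (P⊎Q ∘ suc)
... | inj₁ p | _             = inj₁ (zero , p)
... | inj₂ _ | inj₁ (k , p)  = inj₁ (suc k , p)
... | inj₂ q | inj₂ qs       = inj₂ λ { zero → q ; (suc k) → qs k }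

sum-nonNegative : ∀ {n} (f : Fin n → ℤ) → sum f ≡ 0ℤ → (∀ k → 0ℤ ≤ᶻ f k) → ∀ k → f k ≡ 0ℤ
sum-nonNegative f total 0≤f k with f k ℤₚ.≟ 0ℤ
... | yes eq = eq
... | no ≢0 with sum-compensate f {k ∷ []} ([] ∷ []) total
                   (subst (0ℤ <ᶻ_) (sym (ℤₚ.+-identityʳ (f k))) (ℤₚ.≤∧≢⇒< (0≤f k) (≢-sym ≢0)))
...   | j , _ , fj<0 = contradiction fj<0 (ℤₚ.≤⇒≯ (0≤f j))

module _ {Φ : CoxType} {n : ℕ} where

  arcEdge-~ : ∀ x y (p : base x ≢ base y) → arcEdge {Φ} {n} x (~ y) p ≢ arcEdge x y p
  arcEdge-~ (i , σ) (j , τ) p eq with F.<-cmp i j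
  ... | tri< i<j _ _ rewrite same-notʳ σ τ = distinct (same σ τ) eq
    where
    distinct : ∀ b → pairEdge {Φ} (not b) j i i<j ≢ pairEdge b j i i<j
    distinct true  ()
    distinct false ()
  ... | tri≈ _ i≡j _ = contradiction i≡j p
  ... | tri> _ _ j<i rewrite same-notʳ σ τ = distinct (same σ τ) eq
    where
    distinct : ∀ b → pairEdge {Φ} (not b) i j j<i ≢ pairEdge b i j j<i
    distinct true  ()
    distinct false ()

  arc-above : ∀ {v} x y (xy : base x ≢ base y) → v ≤ base x → v ≤ base y →
      ¬ Below v (arcEdge {Φ} {n} x y xy)
  arc-above x y xy v≤x v≤y (u , u<v , t) with arcEdge-touched x y xy t
  ... | inj₁ refl = ℕₚ.<⇒≱ u<v v≤x
  ... | inj₂ refl = ℕₚ.<⇒≱ u<v v≤y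

  SpokeGoal : ∀ {v} (T₁ T₂ : Tournament Φ n) x → v < base x → Edge Φ n → Set
  SpokeGoal {v} T₁ T₂ x v<x e = e ≡ spoke x v<x ⊎ Kept v T₁ T₂ e

  spokeGoal-upto : ∀ {v} {T₁ T₂ : Tournament Φ n} x (v<x : v < base x) {e} → SpokeGoal T₁ T₂ x v<x e →
      Upto v e
  spokeGoal-upto x v<x (inj₁ refl) = spoke-upto x v<x
  spokeGoal-upto x v<x (inj₂ kept) = proj₁ kept

  -- Flipping G in T repairs the spoke x at the price of the spoke z.
  module Reroute {v} (T T′ : Tournament Φ n) (x z : Signed n) (v<x : v < base x) (v<z : v < base z)
      (xz : base x ≢ base z)
    (G : List (Edge Φ n)) (x∈G : spoke x v<x ∈ G) (z∈G : spoke z v<z ∈ G)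
    (G⊆ : ∀ {e} → e ∈ G → e ≡ spoke x v<x ⊎ e ≡ spoke z v<z ⊎ ¬ Upto v e)
    (x-differs : T (spoke x v<x) ≢ T′ (spoke x v<x)) (step : Step T (flip G T))
    (score : SameScore T T′) (agree : AgreeOn (Below v) T T′) where
    open DecMembership (_≟ᴱ_ {Φ} {n}) using (_∈?_)

    U : Tournament Φ n
    U = flip G T

    score′ : SameScore U T′
    score′ = sameScore-left {T₂ = T′} step score

    opposite∉G : spoke (~ x) v<x ∉ G
    opposite∉G x̃∈G with G⊆ x̃∈G
    ... | inj₁ eq = arcEdge-~ (hub v) x (F.<⇒≢ v<x) eq
    ... | inj₂ (inj₂ ¬up) = ¬up (spoke-upto (~ x) v<x)
    ... | inj₂ (inj₁ eq)
      with arcEdge-touched (hub v) z (F.<⇒≢ v<z)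
          (subst (λ e → Touches e (base x)) eq (arcEdge-touches (hub v) (~ x) (F.<⇒≢ v<x) (inj₂ refl)))
    ...   | inj₁ x≡v = F.<⇒≢ v<x (sym x≡v)
    ...   | inj₂ x≡z = xz x≡z

    agree′ : AgreeOn (Below v) U T′
    agree′ e below = trans (flip-∉ e∉G) (agree e below)
      where
      e∉G : e ∉ G
      e∉G e∈G with G⊆ e∈G
      ... | inj₁ refl = arc-above (hub v) x (F.<⇒≢ v<x) ℕₚ.≤-refl (ℕₚ.<⇒≤ v<x) below
      ... | inj₂ (inj₁ refl) = arc-above (hub v) z (F.<⇒≢ v<z) ℕₚ.≤-refl (ℕₚ.<⇒≤ v<z) below
      ... | inj₂ (inj₂ ¬up) = ¬up (below⇒upto e below)

    goal′ : ∀ e → SpokeGoal T T′ x v<x e → e ≡ spoke z v<z ⊎ Kept v U T′ e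
    goal′ e goal with e ∈? G
    ... | yes e∈G with G⊆ e∈G
    ...   | inj₁ refl = inj₂ (spoke-upto x v<x , ≢⇒not≡ x-differs)
    ...   | inj₂ (inj₁ eq) = inj₁ eq
    ...   | inj₂ (inj₂ ¬up) = contradiction (spokeGoal-upto {T₁ = T} {T′} x v<x goal) ¬up
    goal′ e (inj₁ refl) | no e∉G = contradiction x∈G e∉G
    goal′ e (inj₂ (up , eq)) | no e∉G = inj₂ (up , eq)

    z-flipped : ∀ {b} → beats T (hub v) z (F.<⇒≢ v<z) ≡ b → beats U (hub v) z (F.<⇒≢ v<z) ≡ not b
    z-flipped eq = trans (beats-not {T = T} {U = U} {hub v} {z} (F.<⇒≢ v<z) (flip-∈ z∈G)) (cong not eq)

    opposite-kept : ∀ {b} → beats T (hub v) (~ x) (F.<⇒≢ v<x) ≡ b →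
        beats U (hub v) (~ x) (F.<⇒≢ v<x) ≡ b
    opposite-kept eq = trans (beats-cong {T = T} {U = U} (hub v) (~ x) (F.<⇒≢ v<x) (flip-∉ opposite∉G))
        eq

CloverFits : CoxType → Bool → Set
CloverFits Φ b = IsC Φ × b ≡ true

-- In `T₁` x loses to both signs of the hub and in `T₂` it beats both, a swing of 4. A half edge
-- offsets at most 2 of it; a loop can offset all of it, but only if it is positive in `T₁`, which
-- is the case left to the clover.
spread-bound : ∀ Φ p₁ p₂ → ¬ CloverFits Φ p₁ →
  0ℤ <ᶻ (sgn true + sgn true - (sgn false + sgn false)) + ((weight Φ * sgn p₂ - weight Φ * sgn p₁) + 0ℤ)
spread-bound B p₁ p₂ _ = decide (∀𝔹? λ p₁ → ∀𝔹? λ p₂ → 0ℤ ℤₚ.<? bound p₁ p₂) p₁ p₂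
  where
  bound : Bool → Bool → ℤ
  bound p₁ p₂ = + 4 + ((+ 1 * sgn p₂ - + 1 * sgn p₁) + 0ℤ)
spread-bound C true  p₂    ¬c = contradiction (tt , refl) ¬c
spread-bound C false true  _ = decide (0ℤ ℤₚ.<? + 8)
spread-bound C false false _ = decide (0ℤ ℤₚ.<? + 4)
spread-bound D p₁ p₂ _ = decide (0ℤ ℤₚ.<? + 4)

negative-sgn : ∀ a b → sgn a - sgn b <ᶻ 0ℤ → a ≡ false × b ≡ true
negative-sgn = decide
    (∀𝔹? λ a → ∀𝔹? λ b → ((sgn a - sgn b) ℤₚ.<? 0ℤ) →-dec ((a 𝔹.≟ false) ×-dec (b 𝔹.≟ true)))

module _ {Φ : CoxType} {n : ℕ} where

  -- The swing of x against the hub forces a z above `v` that x beats in `T₁` and loses to in `T₂`.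
  -- The triangle on hub, x and z is cyclic in one of the tournaments; flipping it moves the
  -- disagreement from x to z, and z and `~ x` form a pair for `pairFix`: 1 + 2 moves.
  oppositeFix-noClover : ∀ {v} {T₁ T₂ : Tournament Φ n} x (v<x : v < base x) →
      ¬ CloverFits Φ (positive T₁ x) →
    SameScore T₁ T₂ → AgreeOn (Below v) T₁ T₂ → Split T₁ T₂ x v<x → Split T₂ T₁ (~ x) v<x →
    (∀ z (v<z : v < base z) → base z ≢ base x →
        beats T₁ (hub v) z (F.<⇒≢ v<z) ≡ beats T₂ (hub v) z (F.<⇒≢ v<z)) →
    Fix T₁ T₂ 3 (SpokeGoal T₁ T₂ x v<x)
  oppositeFix-noClover {v} {T₁} {T₂} x v<x ¬c score agree sx sx̃ others =
      locate (sum-compensate (rowDiff T₂ T₁ x) unique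
      (rowDiff-sum {T₁ = T₂} {T₁} (sameScore-sym {T₁ = T₁} {T₂} score) x) exceptional)
    where
    V = hub v
    vx = F.<⇒≢ v<x
    xv = ≢-sym vx
    unique : Unique (v ∷ base x ∷ [])
    unique = (vx ∷ []) ∷ [] ∷ []
    exceptional : 0ℤ <ᶻ rowDiff T₂ T₁ x v + (rowDiff T₂ T₁ x (base x) + 0ℤ)
    exceptional rewrite rowDiff-at T₂ T₁ x V xv | rowDiff-self T₂ T₁ x
      | beats-rev T₁ V x vx xv (proj₁ sx) | beats-rev T₂ V x vx xv (proj₂ sx)
      | trans (beats-skew T₁ V x vx xv) (proj₂ sx̃) | trans (beats-skew T₂ V x vx xv) (proj₁ sx̃) =
      spread-bound Φ (positive T₁ x) (positive T₂ x) ¬c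

    via : ∀ z (v<z : v < base z) (xz : base x ≢ base z) → beats T₁ x z xz ≡ true →
        beats T₂ x z xz ≡ false →
          Fix T₁ T₂ 3 (SpokeGoal T₁ T₂ x v<x)
    via z v<z xz b₁ b₂ with beats T₁ V z (F.<⇒≢ v<z) in b
    -- Here z beats the hub in both tournaments, so hub, x, z is cyclic in `T₁`. After the flip the
    -- spoke of z differs in the direction opposite to that of `~ x`.
    ... | false = fix-left s (fix-map goal (pairFix z (~ x) v<z v<x zx score′ agree′
                    (z-flipped b , trans (sym (others z v<z zx)) b)
                        (proj₁ sx̃ , opposite-kept (proj₂ sx̃))))
      where
      zx = ≢-sym xz
      vz = F.<⇒≢ v<z
      zv = ≢-sym vz
      z–v : spoke z v<z ≡ arcEdge z V zv
      z–v = sym (arcEdge-sym V z vz zv)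
      s = triangle-step {T = T₁} V x z vx xz zv (proj₁ sx) b₁ (beats-rev T₁ V z vz zv b)
      G⊆ : ∀ {e} → e ∈ triangle V x z vx xz zv → e ≡ spoke x v<x ⊎ e ≡ spoke z v<z ⊎ ¬ Upto v e
      G⊆ (here eq) = inj₁ eq
      G⊆ (there (here refl)) = inj₂ (inj₂ (arc-free x z xz v<x v<z))
      G⊆ (there (there (here eq))) = inj₂ (inj₁ (trans eq (sym z–v)))
      open Reroute T₁ T₂ x z v<x v<z xz (triangle V x z vx xz zv) (here refl) (there (there (here z–v)))
          G⊆
        (split-differs x v<x sx) s score agree
      goal : ∀ e → SpokeGoal T₁ T₂ x v<x e → PairGoal U T₂ z (~ x) v<z v<x e
      goal e g = Sum.map₂ inj₂ (goal′ e g)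
    -- Here the hub beats z in both tournaments, so hub, z, x is cyclic in `T₂` and the trade is
    -- made there.
    ... | true = fix-swap
        (fix-left s (fix-swap
        (fix-map goal (pairFix z (~ x) v<z v<x zx (sameScore-sym {T₁ = U} {T₁} score′)
                   (λ e below → sym (agree′ e below)) (b , z-flipped z₂)
                       (opposite-kept (proj₁ sx̃) , proj₂ sx̃)))))
      where
      zx = ≢-sym xz
      vz = F.<⇒≢ v<z
      x–v : spoke x v<x ≡ arcEdge x V xv
      x–v = sym (arcEdge-sym V x vx xv)
      z₂ = trans (sym (others z v<z zx)) b
      s = triangle-step {T = T₂} V z x vz zx xv z₂ (beats-rev T₂ x z xz zx b₂)
          (beats-rev T₂ V x vx xv (proj₂ sx))
      G⊆ : ∀ {e} → e ∈ triangle V z x vz zx xv → e ≡ spoke x v<x ⊎ e ≡ spoke z v<z ⊎ ¬ Upto v e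
      G⊆ (here eq) = inj₂ (inj₁ eq)
      G⊆ (there (here refl)) = inj₂ (inj₂ (arc-free z x zx v<z v<x))
      G⊆ (there (there (here eq))) = inj₁ (trans eq (sym x–v))
      open Reroute T₂ T₁ x z v<x v<z xz (triangle V z x vz zx xv) (there (there (here x–v))) (here refl)
          G⊆
        (split-differs x v<x sx ∘ sym) s (sameScore-sym {T₁ = T₁} {T₂} score)
            (λ e below → sym (agree e below))
      goal : ∀ e → SpokeGoal T₁ T₂ x v<x e → PairGoal T₁ U z (~ x) v<z v<x e
      goal e g with goal′ e (Sum.map₂ (λ (up , eq) → up , sym eq) g)
      ... | inj₁ eq = inj₁ eq
      ... | inj₂ (up , eq) = inj₂ (inj₂ (up , sym eq))

    locate : (∃[ k ] (k ∉ v ∷ base x ∷ []) × rowDiff T₂ T₁ x k <ᶻ 0ℤ) →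
        Fix T₁ T₂ 3 (SpokeGoal T₁ T₂ x v<x)
    locate (k , k∉ , diff<0) with F.<-cmp v k
    ... | tri≈ _ refl _ = contradiction (here refl) k∉
    ... | tri> _ _ k<v = contradiction diff<0 (ℤₚ.<-irrefl
            (rowDiff-below {T₁ = T₂} {T₁} x (λ { refl → k∉ (there (here refl)) })
                (λ e below → sym (agree e below)) k<v))
    ... | tri< v<k _ _ =
        [ conclude true , conclude false ]′
        (negative-+ {term true} {term false} (subst (_<ᶻ 0ℤ) terms diff<0))
      where
      xk : base x ≢ k
      xk refl = k∉ (there (here refl))
      s : Tournament Φ n → Bool → ℤ
      s T τ = sgn (beats T x (k , τ) xk)
      term : Bool → ℤ
      term τ = s T₂ τ - s T₁ τ
      shuffle : ∀ a b c d → a + b - (c + d) ≡ (a - c) + (b - d)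
      shuffle = solve-∀
      terms : rowDiff T₂ T₁ x k ≡ term true + term false
      terms = trans (rowDiff-at T₂ T₁ x (k , true) xk)
          (shuffle (s T₂ true) (s T₂ false) (s T₁ true) (s T₁ false))
      conclude : ∀ τ → term τ <ᶻ 0ℤ → Fix T₁ T₂ 3 (SpokeGoal T₁ T₂ x v<x)
      conclude τ t<0 with negative-sgn (beats T₂ x (k , τ) xk) (beats T₁ x (k , τ) xk) t<0
      ... | b₂ , b₁ = via (k , τ) v<k xk b₁ b₂

-- In `T₁`, `~ x` beats both signs of the hub and its loop counts negatively. The clover contains
-- both differing spokes, and its loop lies above `v`.
cloverFix : ∀ {n} {v : Fin n} {T₁ T₂ : Tournament C n} x (v<x : v < base x) → positive T₁ x ≡ true →
  Split T₁ T₂ x v<x → Split T₂ T₁ (~ x) v<x → Fix T₁ T₂ 1 (SpokeGoal T₁ T₂ x v<x)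
cloverFix {n} {v} {T₁} {T₂} x v<x px sx sx̃ =
  fix-left (clover-step {T = T₁} (~ x) V xv b₁ b₂ (trans (positive-~ T₁ x) (cong not px)))
      (fix-none agree)
  where
  open DecMembership (_≟ᴱ_ {C} {n}) using (_∈?_)
  V = hub v
  vx = F.<⇒≢ v<x
  xv = ≢-sym vx
  G = clover (~ x) V xv
  b₁ : beats T₁ (~ x) V xv ≡ true
  b₁ = beats-rev T₁ V (~ x) vx xv (proj₂ sx̃)
  b₂ : beats T₁ (~ x) (~ V) xv ≡ true
  b₂ = trans (beats-~ˡ T₁ x (~ V) xv) (cong not (beats-rev T₁ V x vx xv (proj₁ sx)))
  x̃–v : arcEdge (~ x) V xv ≡ spoke (~ x) v<x
  x̃–v = arcEdge-sym V (~ x) vx xv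
  x–v : arcEdge (~ x) (~ V) xv ≡ spoke x v<x
  x–v = trans (arcEdge-skew V (~ x) vx xv)
      (cong (λ σ → spoke (base x , σ) v<x) (𝔹.not-involutive (proj₂ x)))
  differs : ∀ e → Upto v e → e ∈ G → T₁ e ≢ T₂ e
  differs e up (here refl) eq = split-differs (~ x) v<x sx̃ (subst (λ f → T₂ f ≡ T₁ f) x̃–v (sym eq))
  differs e up (there (here refl)) eq = split-differs x v<x sx (subst (λ f → T₁ f ≡ T₂ f) x–v eq)
  differs e up (there (there (here refl))) = contradiction up (loop-free v<x)
  agree : AgreeOn (SpokeGoal T₁ T₂ x v<x) (flip G T₁) T₂
  agree e goal with e ∈? G
  ... | yes e∈G = ≢⇒not≡ (differs e (spokeGoal-upto {T₁ = T₁} {T₂} x v<x goal) e∈G)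
  ... | no e∉G with goal
  ...   | inj₁ refl = contradiction (there (here (sym x–v))) e∉G
  ...   | inj₂ kept = proj₂ kept

-- Correcting one spoke

-- The split spoke contributes 2 to the hub's entry at `base x`; the opposite spoke cancels this
-- only if it is split the other way.
paired-balance : ∀ a b → 0ℤ ≤ᶻ (sgn true + sgn a - (sgn false + sgn b)) ×
  ((sgn true + sgn a - (sgn false + sgn b)) ≡ 0ℤ → b ≡ true × a ≡ false)
paired-balance = decide
    (∀𝔹? λ a → ∀𝔹? λ b →
    (0ℤ ℤₚ.≤? diff a b) ×-dec ((diff a b ℤₚ.≟ 0ℤ) →-dec ((b 𝔹.≟ true) ×-dec (a 𝔹.≟ false))))
  where
  diff : Bool → Bool → ℤ
  diff a b = sgn true + sgn a - (sgn false + sgn b)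

unpaired-balance : ∀ a₁ b₁ a₂ b₂ → ¬ (a₂ ≡ true × a₁ ≡ false) → ¬ (b₂ ≡ true × b₁ ≡ false) →
  0ℤ ≤ᶻ (sgn a₁ + sgn b₁ - (sgn a₂ + sgn b₂)) ×
      ((sgn a₁ + sgn b₁ - (sgn a₂ + sgn b₂)) ≡ 0ℤ → a₁ ≡ a₂ × b₁ ≡ b₂)
unpaired-balance = decide (∀𝔹? λ a₁ → ∀𝔹? λ b₁ → ∀𝔹? λ a₂ → ∀𝔹? λ b₂ →
  (¬? ((a₂ 𝔹.≟ true) ×-dec (a₁ 𝔹.≟ false))) →-dec ((¬? ((b₂ 𝔹.≟ true) ×-dec (b₁ 𝔹.≟ false))) →-dec
  ((0ℤ ℤₚ.≤? diff a₁ b₁ a₂ b₂) ×-dec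
      ((diff a₁ b₁ a₂ b₂ ℤₚ.≟ 0ℤ) →-dec ((a₁ 𝔹.≟ a₂) ×-dec (b₁ 𝔹.≟ b₂))))))
  where
  diff : Bool → Bool → Bool → Bool → ℤ
  diff a₁ b₁ a₂ b₂ = sgn a₁ + sgn b₁ - (sgn a₂ + sgn b₂)

-- Each sum is -2, 0 or 2, so of two unequal sums the smaller is -2 or the larger is 2.
deficit : ∀ a₁ b₁ a₂ b₂ → (sgn a₁ + sgn b₁ - (sgn a₂ + sgn b₂)) <ᶻ 0ℤ → (a₁ ≡ false × b₁ ≡ false) ⊎
    (a₂ ≡ true × b₂ ≡ true)
deficit = decide (∀𝔹? λ a₁ → ∀𝔹? λ b₁ → ∀𝔹? λ a₂ → ∀𝔹? λ b₂ →
    ((sgn a₁ + sgn b₁ - (sgn a₂ + sgn b₂)) ℤₚ.<? 0ℤ) →-dec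
  (((a₁ 𝔹.≟ false) ×-dec (b₁ 𝔹.≟ false)) ⊎-dec ((a₂ 𝔹.≟ true) ×-dec (b₂ 𝔹.≟ true))))

oppositeFix : ∀ {Φ n} {v : Fin n} {T₁ T₂ : Tournament Φ n} x (v<x : v < base x) →
  SameScore T₁ T₂ → AgreeOn (Below v) T₁ T₂ → Split T₁ T₂ x v<x → Split T₂ T₁ (~ x) v<x →
  (∀ z (v<z : v < base z) → base z ≢ base x →
      beats T₁ (hub v) z (F.<⇒≢ v<z) ≡ beats T₂ (hub v) z (F.<⇒≢ v<z)) →
  Fix T₁ T₂ 3 (SpokeGoal T₁ T₂ x v<x)
oppositeFix {B} x v<x = oppositeFix-noClover x v<x λ ()
oppositeFix {D} x v<x = oppositeFix-noClover x v<x λ ()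
oppositeFix {C} {T₁ = T₁} x v<x score agree sx sx̃ others with positive T₁ x in px
... | true  = fix-weaken (s≤s z≤n) (cloverFix x v<x px sx sx̃)
... | false = oppositeFix-noClover x v<x (λ (_ , eq) → contradiction (trans (sym eq) px) λ ()) score
    agree sx sx̃ others

module _ {Φ : CoxType} {n : ℕ} where

  -- Without a partner at another vertex all entries of the hub's row difference are nonnegative;
  -- they sum to zero, so all vanish. This leaves `~ x` as the only other differing spoke. Equality
  -- of `extraBit` makes the diagonal entry vanish.
  spokeFix : ∀ {v} {T₁ T₂ : Tournament Φ n} x (v<x : v < base x) → SameScore T₁ T₂ →
      AgreeOn (Below v) T₁ T₂ →
    extraBit T₁ v ≡ extraBit T₂ v → Split T₁ T₂ x v<x → Fix T₁ T₂ 3 (SpokeGoal T₁ T₂ x v<x)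
  spokeFix {v} {T₁} {T₂} x v<x score agree extra≡ sx = [ withPartner , withoutPartner ]′ (choose search)
    where
    V = hub v
    diff = rowDiff T₁ T₂ V
    Partner Settled Unpaired : Fin n → Set
    Partner j = ∃[ τ ] Σ (v < j) λ v<j → j ≢ base x × Split T₂ T₁ (j , τ) v<j
    Settled j = (j ≡ base x → Split T₂ T₁ (~ x) v<x) ×
                (∀ τ (v<j : v < j) → j ≢ base x →
                    beats T₁ V (j , τ) (F.<⇒≢ v<j) ≡ beats T₂ V (j , τ) (F.<⇒≢ v<j))
    Unpaired j = 0ℤ ≤ᶻ diff j × (diff j ≡ 0ℤ → Settled j)

    search : ∀ j → Partner j ⊎ Unpaired j
    search j with F.<-cmp v j
    ... | tri≈ _ refl _ = inj₂ (ℤₚ.≤-reflexive (sym diff≡0) ,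
            λ _ → (λ v≡x → contradiction v≡x (F.<⇒≢ v<x)) , λ _ v<v → contradiction refl (F.<⇒≢ v<v))
      where
      diff≡0 : diff v ≡ 0ℤ
      diff≡0 = trans (rowDiff-self T₁ T₂ V)
          (trans (cong (λ b → weight Φ * sgn b - weight Φ * sgn (extraBit T₂ v)) extra≡)
                 (ℤₚ.+-inverseʳ (weight Φ * sgn (extraBit T₂ v))))
    ... | tri> _ v≢j j<v = inj₂ (ℤₚ.≤-reflexive (sym (rowDiff-below {T₁ = T₁} {T₂} V v≢j agree j<v)) ,
            λ _ → (λ { refl → contradiction v<x (F.<-asym j<v) }) , λ _ v<j →
                contradiction v<j (F.<-asym j<v))
    ... | tri< v<j v≢j _ with j F.≟ base x
    ...   | yes refl = inj₂ (subst (λ d → 0ℤ ≤ᶻ d × (d ≡ 0ℤ → Settled j)) (sym at-x)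
              (proj₁ bal , λ eq → (λ _ → proj₂ bal eq) , λ _ _ j≢j → contradiction refl j≢j))
      where
      bal = paired-balance (beats T₁ V (~ x) v≢j) (beats T₂ V (~ x) v≢j)
      at-x : diff j ≡ sgn true + sgn (beats T₁ V (~ x) v≢j) - (sgn false + sgn (beats T₂ V (~ x) v≢j))
      at-x = trans (rowDiff-at T₁ T₂ V x v≢j)
          (cong₂ (λ a b → sgn a + sgn (beats T₁ V (~ x) v≢j) - (sgn b + sgn (beats T₂ V (~ x) v≢j)))
          (proj₁ sx) (proj₂ sx))
    ...   | no j≢x with split? true | split? false
      where
      split? : ∀ τ → Dec (Split T₂ T₁ (j , τ) v<j)
      split? τ = (beats T₂ V (j , τ) _ 𝔹.≟ true) ×-dec (beats T₁ V (j , τ) _ 𝔹.≟ false)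
    ...     | yes s | _ = inj₁ (true , v<j , j≢x , s)
    ...     | no _ | yes s = inj₁ (false , v<j , j≢x , s)
    ...     | no ¬s₁ | no ¬s₂ =
        inj₂ (subst (λ d → 0ℤ ≤ᶻ d × (d ≡ 0ℤ → Settled j)) (sym (rowDiff-at T₁ T₂ V (j , true) v≢j))
                (proj₁ bal , λ eq → (λ j≡x → contradiction j≡x j≢x) ,
                  λ { true _ _ → proj₁ (proj₂ bal eq) ; false _ _ → proj₂ (proj₂ bal eq) }))
      where
      bal = unpaired-balance (beats T₁ V (j , true) v≢j) (beats T₁ V (j , false) v≢j)
              (beats T₂ V (j , true) v≢j) (beats T₂ V (j , false) v≢j) ¬s₁ ¬s₂

    withPartner : ∃ Partner → Fix T₁ T₂ 3 (SpokeGoal T₁ T₂ x v<x)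
    withPartner (j , τ , v<j , j≢x , sy) = fix-weaken (s≤s (s≤s z≤n))
      (fix-map (λ e → Sum.map₂ inj₂) (pairFix x (j , τ) v<x v<j (≢-sym j≢x) score agree sx sy))

    withoutPartner : (∀ j → Unpaired j) → Fix T₁ T₂ 3 (SpokeGoal T₁ T₂ x v<x)
    withoutPartner unpaired = oppositeFix x v<x score agree sx (proj₁ (settled (base x)) refl)
      λ z v<z z≢x → proj₂ (settled (base z)) (proj₂ z) v<z z≢x
      where
      settled : ∀ j → Settled j
      settled j = proj₂ (unpaired j)
          (sum-nonNegative diff (rowDiff-sum {T₁ = T₁} {T₂} score V) (proj₁ ∘ unpaired) j)

-- The half edge or loop at the hub

extraAt-bit : ∀ {Φ n} {v : Fin n} (T : Tournament Φ n) e → ExtraAt v e → T e ≡ extraBit T v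
extraAt-bit {B} T (half i _) refl = refl
extraAt-bit {C} T (loop i _) refl = refl
extraAt-bit {C} T (half i ()) _
extraAt-bit {D} T (half i ()) _
extraAt-bit {B} T (loop i ()) _
extraAt-bit {D} T (loop i ()) _

extraAt-touches : ∀ {Φ n} {v : Fin n} (e : Edge Φ n) → ExtraAt v e → Touches e v
extraAt-touches (half i _) refl = refl
extraAt-touches (loop i _) refl = refl

extraBit-weight : ∀ {Φ n} {v : Fin n} (T : Tournament Φ n) → extraBit T v ≡ false → 0ℤ <ᶻ weight Φ
extraBit-weight {B} T _ = decide (0ℤ ℤₚ.<? + 1)
extraBit-weight {C} T _ = decide (0ℤ ℤₚ.<? + 2)

ExtraMove : ∀ {Φ n} → Fin n → Tournament Φ n → Set
ExtraMove v T = ∃[ G ] Step T (flip G T) × (∀ e → e ∈ G → ¬ Below v e) × (∀ e → ExtraAt v e → e ∈ G)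

-- Beating both signs of `k`, x beats in particular the one under which the half edge at `k` is
-- positive, which gives a half triangle. In type C the two wins and the negative loop of x form a
-- clover.
extraMove : ∀ {Φ n} (T : Tournament Φ n) x {k} (xk : base x ≢ k) → base x < k → 0ℤ <ᶻ weight Φ →
  (∀ τ → beats T x (k , τ) xk ≡ true) → positive T x ≡ false → ExtraMove (base x) T
extraMove {B} T x {k} xk x<k w wins px =
  halfTriangle x y xk , halfTriangle-step x y xk (wins (extraBit T k)) px (same-refl (extraBit T k)) ,
      above , covers
  where
  y = k , extraBit T k
  same-refl : ∀ b → same b b ≡ true
  same-refl true  = refl
  same-refl false = refl
  above : ∀ e → e ∈ halfTriangle x y xk → ¬ Below (base x) e
  above e (here refl) = arc-above x y xk ℕₚ.≤-refl (ℕₚ.<⇒≤ x<k)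
  above e (there (here refl)) (u , u<x , refl) = ℕₚ.<-irrefl refl u<x
  above e (there (there (here refl))) (u , u<x , refl) = ℕₚ.<-asym u<x x<k
  covers : ∀ e → ExtraAt (base x) e → e ∈ halfTriangle x y xk
  covers (half i _) refl = there (here refl)
extraMove {C} T x {k} xk x<k w wins px =
  clover x y xk , clover-step x y xk (wins true) (wins false) px , above , covers
  where
  y = k , true
  above : ∀ e → e ∈ clover x y xk → ¬ Below (base x) e
  above e (here refl) = arc-above x y xk ℕₚ.≤-refl (ℕₚ.<⇒≤ x<k)
  above e (there (here refl)) = arc-above x (~ y) xk ℕₚ.≤-refl (ℕₚ.<⇒≤ x<k)
  above e (there (there (here refl))) (u , u<x , refl) = ℕₚ.<-irrefl refl u<x
  covers : ∀ e → ExtraAt (base x) e → e ∈ clover x y xk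
  covers (loop i _) refl = there (there (here refl))
extraMove {D} T x xk x<k (+<+ ())

module _ {Φ : CoxType} {n : ℕ} where

  ExtraGoal : Fin n → Edge Φ n → Set
  ExtraGoal v e = Below v e ⊎ ExtraAt v e

  extraMove-fix : ∀ {v} {T₁ T₂ : Tournament Φ n} → AgreeOn (Below v) T₁ T₂ →
      extraBit T₁ v ≢ extraBit T₂ v →
                  ExtraMove v T₁ → Fix T₁ T₂ 1 (ExtraGoal v)
  extraMove-fix {v} {T₁} {T₂} agree bits (G , s , above , covers) = fix-left s (fix-none agree′)
    where
    agree′ : AgreeOn (ExtraGoal v) (flip G T₁) T₂
    agree′ e (inj₁ below) = trans (flip-∉ λ e∈G → above e e∈G below) (agree e below)
    agree′ e (inj₂ at) =
        trans (flip-∈ (covers e at))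
        (trans (cong not (extraAt-bit T₁ e at)) (trans (≢⇒not≡ bits) (sym (extraAt-bit T₂ e at))))

  -- The diagonal entry of the hub's row difference is positive, so some entry above `v` is
  -- negative. By `deficit`, `~ hub v` beats both signs of that vertex in `T₁` or `hub v` does in
  -- `T₂`. The move may change spokes of `v`, which are treated only afterwards.
  imbalanceFix : ∀ {v} {T₁ T₂ : Tournament Φ n} → SameScore T₁ T₂ → AgreeOn (Below v) T₁ T₂ →
    extraBit T₁ v ≡ true → extraBit T₂ v ≡ false → Fix T₁ T₂ 1 (ExtraGoal v)
  imbalanceFix {v} {T₁} {T₂} score agree e₁ e₂ =
      locate (sum-compensate diff {v ∷ []} ([] ∷ []) (rowDiff-sum {T₁ = T₁} {T₂} score V) excess)
    where
    V = hub v
    diff = rowDiff T₁ T₂ V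
    w = extraBit-weight T₂ e₂
    gain : ∀ Φ → 0ℤ <ᶻ weight Φ → 0ℤ <ᶻ (weight Φ * sgn true - weight Φ * sgn false) + 0ℤ
    gain B _ = decide (0ℤ ℤₚ.<? + 2)
    gain C _ = decide (0ℤ ℤₚ.<? + 4)
    gain D (+<+ ())
    excess : 0ℤ <ᶻ diff v + 0ℤ
    excess rewrite rowDiff-self T₁ T₂ V | e₁ | e₂ = gain Φ w
    distinct : extraBit T₁ v ≢ extraBit T₂ v
    distinct eq with trans (sym e₁) (trans eq e₂)
    ... | ()
    locate : (∃[ k ] (k ∉ v ∷ []) × diff k <ᶻ 0ℤ) → Fix T₁ T₂ 1 (ExtraGoal v)
    locate (k , k∉ , diff<0) with F.<-cmp v k
    ... | tri≈ _ refl _ = contradiction (here refl) k∉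
    ... | tri> _ v≢k k<v =
        contradiction diff<0 (ℤₚ.<-irrefl (rowDiff-below {T₁ = T₁} {T₂} V v≢k agree k<v))
    ... | tri< v<k v≢k _ with deficit (beats T₁ V (k , true) v≢k) (beats T₁ V (k , false) v≢k)
        (beats T₂ V (k , true) v≢k) (beats T₂ V (k , false) v≢k)
                                (subst (_<ᶻ 0ℤ) (rowDiff-at T₁ T₂ V (k , true) v≢k) diff<0)
    ...   | inj₁ (bt , bf) =
        extraMove-fix agree distinct (extraMove T₁ (~ V) v≢k v<k w wins (cong not e₁))
      where
      wins : ∀ τ → beats T₁ (~ V) (k , τ) v≢k ≡ true
      wins true  = trans (beats-~ˡ T₁ V (k , true) v≢k) (cong not bf)
      wins false = trans (beats-~ˡ T₁ V (k , false) v≢k) (cong not bt)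
    ...   | inj₂ (bt , bf) = fix-swap (extraMove-fix (λ e below → sym (agree e below)) (≢-sym distinct)
              (extraMove T₂ V v≢k v<k w (λ { true → bt ; false → bf }) e₂))

  extraFix : ∀ {v} {T₁ T₂ : Tournament Φ n} → SameScore T₁ T₂ → AgreeOn (Below v) T₁ T₂ →
      Fix T₁ T₂ 1 (ExtraGoal v)
  extraFix {v} {T₁} {T₂} score agree with extraBit T₁ v in e₁ | extraBit T₂ v in e₂
  ... | true  | false = imbalanceFix score agree e₁ e₂
  ... | false | true  =
      fix-swap (imbalanceFix (sameScore-sym {T₁ = T₁} {T₂} score) (λ e below → sym (agree e below)) e₂
      e₁)
  ... | true  | true  = fix-none λ { e (inj₁ below) → agree e below
                                   ; e (inj₂ at) → trans (extraAt-bit T₁ e at)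
                                       (trans e₁ (sym (trans (extraAt-bit T₂ e at) e₂))) }
  ... | false | false = fix-none λ { e (inj₁ below) → agree e below
                                   ; e (inj₂ at) → trans (extraAt-bit T₁ e at)
                                       (trans e₁ (sym (trans (extraAt-bit T₂ e at) e₂))) }

  extraBit-agree : ∀ {v} {T₁ T₂ : Tournament Φ n} → AgreeOn (ExtraAt v) T₁ T₂ →
      extraBit T₁ v ≡ extraBit T₂ v
  extraBit-agree {v} {T₁} {T₂} agree = go Φ refl
    where
    go : ∀ Ψ → Ψ ≡ Φ → extraBit T₁ v ≡ extraBit T₂ v
    go B refl = agree (half v tt) refl
    go C refl = agree (loop v tt) refl
    go D refl = refl

  -- All spokes, all vertices and the total cost

  IsSpoke : Fin n → Signed n → Edge Φ n → Set
  IsSpoke v x e = Σ (v < base x) λ v<x → e ≡ spoke x v<x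

  -- `P` is the set already in agreement. Its lower bound supplies the hypotheses of `spokeFix`; its
  -- upper bound places it inside `Kept`, so that it survives.
  oneSpoke : ∀ {v} {T₁ T₂ : Tournament Φ n} (P : Edge Φ n → Set) → (∀ e → ExtraGoal v e → P e) →
      (∀ e → P e → Upto v e) →
    ∀ x → SameScore T₁ T₂ → AgreeOn P T₁ T₂ → Fix T₁ T₂ 3 (λ e → P e ⊎ IsSpoke v x e)
  oneSpoke {v} {T₁} {T₂} P lower upper x score agree with v <? base x
  ... | no v≮x = fix-none λ { e (inj₁ Pe) → agree e Pe ; e (inj₂ (v<x , _)) → contradiction v<x v≮x }
  ... | yes v<x with beats T₁ (hub v) x (F.<⇒≢ v<x) in b₁ | beats T₂ (hub v) x (F.<⇒≢ v<x) in b₂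
  ...   | true  | true  =
      fix-none λ { e (inj₁ Pe) → agree e Pe ; e (inj₂ (_ , refl)) →
      beats-injective (hub v) x _ (trans b₁ (sym b₂)) }
  ...   | false | false =
      fix-none λ { e (inj₁ Pe) → agree e Pe ; e (inj₂ (_ , refl)) →
      beats-injective (hub v) x _ (trans b₁ (sym b₂)) }
  ...   | true  | false =
      fix-map goal (spokeFix x v<x score (λ e → agree e ∘ lower e ∘ inj₁)
      (extraBit-agree (λ e → agree e ∘ lower e ∘ inj₂)) (b₁ , b₂))
    where
    goal : ∀ e → P e ⊎ IsSpoke v x e → SpokeGoal T₁ T₂ x v<x e
    goal e (inj₁ Pe) = inj₂ (upper e Pe , agree e Pe)
    goal e (inj₂ (_ , eq)) = inj₁ eq
  ...   | false | true  =
      fix-swap (fix-map goal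
      (spokeFix x v<x (sameScore-sym {T₁ = T₁} {T₂} score)
      (λ e below → sym (agree e (lower e (inj₁ below))))
                            (sym (extraBit-agree (λ e → agree e ∘ lower e ∘ inj₂))) (b₂ , b₁)))
    where
    goal : ∀ e → P e ⊎ IsSpoke v x e → SpokeGoal T₂ T₁ x v<x e
    goal e (inj₁ Pe) = inj₂ (upper e Pe , sym (agree e Pe))
    goal e (inj₂ (_ , eq)) = inj₁ eq

  allSpokes : ∀ {v} {T₁ T₂ : Tournament Φ n} (P : Edge Φ n → Set) → (∀ e → ExtraGoal v e → P e) →
      (∀ e → P e → Upto v e) →
    ∀ xs → SameScore T₁ T₂ → AgreeOn P T₁ T₂ →
        Fix T₁ T₂ (length xs ℕ* 3) (λ e → P e ⊎ ∃[ x ] x ∈ xs × IsSpoke v x e)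
  allSpokes P lower upper [] score agree =
      fix-none λ { e (inj₁ Pe) → agree e Pe ; e (inj₂ (_ , () , _)) }
  allSpokes {v} P lower upper (x ∷ xs) score agree =
      fix-map goal (fix-bind score (oneSpoke P lower upper x score agree)
    (allSpokes (λ e → P e ⊎ IsSpoke v x e) (λ e → inj₁ ∘ lower e) upper′ xs))
    where
    upper′ : ∀ e → P e ⊎ IsSpoke v x e → Upto v e
    upper′ e (inj₁ Pe) = upper e Pe
    upper′ e (inj₂ (v<x , refl)) = spoke-upto x v<x
    goal : ∀ e → P e ⊎ (∃[ y ] y ∈ x ∷ xs × IsSpoke v y e) → (P e ⊎ IsSpoke v x e) ⊎
        (∃[ y ] y ∈ xs × IsSpoke v y e)
    goal e (inj₁ Pe) = inj₁ (inj₁ Pe)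
    goal e (inj₂ (_ , here refl , s)) = inj₁ (inj₂ s)
    goal e (inj₂ (y , there y∈xs , s)) = inj₂ (y , y∈xs , s)

  touches-cases : ∀ {v} (e : Edge Φ n) → Touches e v → ExtraAt v e ⊎ ∃[ x ] Σ (v ≢ base x) λ vx →
      e ≡ arcEdge (hub v) x vx
  touches-cases (half i _) refl = inj₁ refl
  touches-cases (loop i _) refl = inj₁ refl
  touches-cases (neg i j j<i) (inj₁ refl) =
      inj₂ ((j , true) , ≢-sym (F.<⇒≢ j<i) , sym (arcEdge-> true true j<i _))
  touches-cases (neg i j j<i) (inj₂ refl) =
      inj₂ ((i , true) , F.<⇒≢ j<i , sym (arcEdge-< true true j<i _))
  touches-cases (pos i j j<i) (inj₁ refl) =
      inj₂ ((j , false) , ≢-sym (F.<⇒≢ j<i) , sym (arcEdge-> true false j<i _))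
  touches-cases (pos i j j<i) (inj₂ refl) =
      inj₂ ((i , false) , F.<⇒≢ j<i , sym (arcEdge-< true false j<i _))

allSigned : ∀ n → List (Signed n)
allSigned n = cartesianProduct (allFin n) (true ∷ false ∷ [])

∈-allSigned : ∀ {n} (x : Signed n) → x ∈ allSigned n
∈-allSigned (i , true)  = ∈-cartesianProduct⁺ (∈-allFin i) (here refl)
∈-allSigned (i , false) = ∈-cartesianProduct⁺ (∈-allFin i) (there (here refl))

length-allSigned : ∀ n → length (allSigned n) ≡ n ℕ* 2
length-allSigned n = trans (double (allFin n)) (cong (_ℕ* 2) (length-tabulate {n = n} id))
  where
  double : ∀ {A : Set} (xs : List A) → length (cartesianProduct xs (true ∷ false ∷ [])) ≡ length xs ℕ* 2
  double []       = refl
  double (_ ∷ xs) = cong (2 ℕ+_) (double xs)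

vertexCost : ℕ → ℕ
vertexCost n = 1 ℕ+ n ℕ* 2 ℕ* 3

module _ {Φ : CoxType} {n : ℕ} where

  vertexFix : ∀ {v} {T₁ T₂ : Tournament Φ n} → SameScore T₁ T₂ → AgreeOn (Below v) T₁ T₂ →
      Fix T₁ T₂ (vertexCost n) (Upto v)
  vertexFix {v} {T₁} {T₂} score agree =
      subst (λ m → Fix T₁ T₂ (1 ℕ+ m ℕ* 3) (Upto v)) (length-allSigned n)
    (fix-map goal (fix-bind score (extraFix score agree)
        (allSpokes (ExtraGoal v) (λ _ → id) upper (allSigned n))))
    where
    upper : ∀ e → ExtraGoal v e → Upto v e
    upper e (inj₁ below) = below⇒upto e below
    upper e (inj₂ at) = v , ℕₚ.≤-refl , extraAt-touches e at
    goal : ∀ e → Upto v e → ExtraGoal v e ⊎ (∃[ x ] x ∈ allSigned n × IsSpoke v x e)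
    goal e (u , u≤v , t) with F.<-cmp u v
    ... | tri< u<v _ _ = inj₁ (inj₁ (u , u<v , t))
    ... | tri> _ _ v<u = contradiction u≤v (ℕₚ.<⇒≱ v<u)
    ... | tri≈ _ refl _ with touches-cases e t
    ...   | inj₁ at = inj₁ (inj₂ at)
    ...   | inj₂ (x , vx , eq) with v <? base x
    ...     | yes v<x = inj₂ (x , ∈-allSigned x , v<x , eq)
    -- A game with a smaller opponent was settled when that opponent was treated.
    ...     | no v≮x = inj₁ (inj₁ (base x , F.≤∧≢⇒< (ℕₚ.≮⇒≥ v≮x) (≢-sym vx) ,
                subst (λ f → Touches f (base x)) (sym eq) (arcEdge-touches (hub v) x vx (inj₂ refl))))

  Prefix : ℕ → Edge Φ n → Set
  Prefix m e = ∃[ u ] toℕ u ℕ.< m × Touches e u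

  prefixFix : ∀ {T₁ T₂ : Tournament Φ n} m → m ℕ.≤ n → SameScore T₁ T₂ →
              Fix T₁ T₂ (m ℕ* vertexCost n) (Prefix m)
  prefixFix zero    _   score = fix-none λ { e (u , () , t) }
  prefixFix {T₁} {T₂} (suc m) m<n score =
      subst (λ c → Fix T₁ T₂ c (Prefix (suc m))) (ℕₚ.+-comm (m ℕ* vertexCost n) (vertexCost n))
    (fix-map goal (fix-bind score (prefixFix m (ℕₚ.<⇒≤ m<n) score) λ score′ agree →
        vertexFix {v = v} score′ (λ e → agree e ∘ below e)))
    where
    v : Fin n
    v = fromℕ< m<n
    v≡m : toℕ v ≡ m
    v≡m = F.toℕ-fromℕ< m<n
    below : ∀ e → Below v e → Prefix m e
    below e (u , u<v , t) = u , subst (toℕ u ℕ.<_) v≡m u<v , t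
    goal : ∀ e → Prefix (suc m) e → Upto v e
    goal e (u , s≤s u≤m , t) = u , subst (toℕ u ℕ.≤_) (sym v≡m) u≤m , t

  touched : ∀ (e : Edge Φ n) → ∃[ u ] Touches e u
  touched (neg i j _) = i , inj₁ refl
  touched (pos i j _) = i , inj₁ refl
  touched (half i _)  = i , refl
  touched (loop i _)  = i , refl

-- For n ≥ 1 the one move for a half edge or loop is bounded by n, so n(1 + 6n) is at most n(n +
-- 6n); hence the constant 7.
totalCost : ∀ n → n ℕ* vertexCost n ℕ.≤ 7 ℕ* (n ℕ* n)
totalCost zero    = z≤n
totalCost n@(suc _) =
    ℕₚ.≤-trans (ℕₚ.*-monoʳ-≤ n (ℕₚ.+-monoˡ-≤ (n ℕ* 2 ℕ* 3) (s≤s z≤n))) (ℕₚ.≤-reflexive (lemma n))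
  where
  lemma : ∀ n → n ℕ* (n ℕ+ n ℕ* 2 ℕ* 3) ≡ 7 ℕ* (n ℕ* n)
  lemma = ℕSolver.solve-∀

theorem5 : ∃[ K ] ((Φ : CoxType) (n : ℕ) (T₁ T₂ : Tournament Φ n) →
    ((k : Fin n) → twiceScore T₁ k ≡ twiceScore T₂ k) →
    ∃[ d ] (d ℕ.≤ K ℕ* (n ℕ* n) × Path T₁ T₂ d))
theorem5 = 7 , λ Φ n T₁ T₂ score → conclude (prefixFix n ℕₚ.≤-refl score)
  where
  conclude : ∀ {Φ n} {T₁ T₂ : Tournament Φ n} → Fix T₁ T₂ (n ℕ* vertexCost n) (Prefix n) →
             ∃[ d ] (d ℕ.≤ 7 ℕ* (n ℕ* n) × Path T₁ T₂ d)
  -- Every game touches some vertex, so agreement on `Prefix n` is agreement everywhere.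
  conclude {n = n} (fix {count = d} d≤ p agree) = d , ℕₚ.≤-trans d≤ (totalCost n) ,
    moves-path p λ e → agree e (proj₁ (touched e) , F.toℕ<n (proj₁ (touched e)) , proj₂ (touched e))
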